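{- Let $p$ be an odd prime. (i) We have $$\sum_{k=0}^{\lfloor 3p/4\rfloor}\frac{\binom{2k}{k}^2}{16^k}\equiv\begin{cases}1\pmod{p^3}&\text{if } p\equiv1\pmod 4,\\[4pt] -1+\dfrac{p^2}{2\binom{(p-3)/2}{(p-3)/4}^2}\pmod{p^3}&\text{if } p\equiv3\pmod 4.\end{cases}$$ (ii) For each integer $a\ge 2$, we have $$\sum_{k=0}^{\lfloor\frac34p^a\rfloor}\frac{\binom{2k}{k}^2}{16^k}\equiv\left(\frac{ -1}{p^a}\right)\pmod{p^3}.$$
   Context: $\left(\frac{\cdot}{\cdot}\right)$ denotes the Jacobi symbol; in particular $\left(\frac{ -1}{p^a}\right)=(-1)^{a(p-1)/2}$. For rational numbers $x,y$ whose denominators are prime to $p$, $x\equiv y\pmod{p^m}$ means that $x-y$ is $p^m$ times a rational number with denominator prime to $p$. -}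

module Defs where

open import Data.Nat as ℕ using (ℕ; zero; suc; _∸_; _^_; _/_)
open import Data.Nat.Combinatorics using (_C_)
open import Data.Nat.Divisibility using (_∣_)
open import Data.Integer as ℤ using (ℤ; +_)
open import Data.Rational as ℚ using (ℚ)
open import Data.Product using (∃; ∃-syntax; _×_)
open import Data.List using (List; map; upTo; foldr)
open import Relation.Nullary using (¬_)
open import Relation.Binary.PropositionalEquality using (_≡_)

-- the rational number n / d (d ≠ 0 in all uses; value 0 for d = 0)
natFrac : ℕ → ℕ → ℚ
natFrac n zero    = ℚ.0ℚ
natFrac n (suc d) = (+ n) ℚ./ suc d

ℤtoℚ : ℤ → ℚ
ℤtoℚ z = z ℚ./ 1

sumTo : ℕ → (ℕ → ℚ) → ℚ
sumTo N f = foldr ℚ._+_ ℚ.0ℚ (map f (upTo (suc N)))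

term : ℕ → ℚ
term k = natFrac (((2 ℕ.* k) C k) ^ 2) (16 ^ k)

-- x ≡ y (mod p^m) for rationals: x - y = p^m * (a / b) with b prime to p
_≡_[modℚ_^_] : ℚ → ℚ → ℕ → ℕ → Set
x ≡ y [modℚ p ^ m ] =
  ∃[ a ] ∃[ b ] (¬ (p ∣ b)) × (ℚ._*_ (ℤtoℚ (+ b)) (x ℚ.- y) ≡ ℚ._*_ (ℤtoℚ (+ (p ^ m))) (ℤtoℚ a))

-- Jacobi symbol (-1 / p^a) = (-1)^(a (p-1)/2), for odd p
jacobiNeg1 : ℕ → ℕ → ℤ
jacobiNeg1 p a = (ℤ.- ℤ.1ℤ) ℤ.^ (a ℕ.* ((p ∸ 1) / 2))

{-# OPTIONS --safe #-}
module Submission where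

open import Defs
open import Data.Nat as ℕ using (ℕ; zero; suc; _∸_; _^_; _/_; _%_; _≤_; _<_; z≤n; s≤s; NonZero)
open import Data.Nat.Combinatorics using (_C_; nCk+nC[k+1]≡[n+1]C[k+1]; nCk≡nC[n∸k]; nCn≡1; k>n⇒nCk≡0)
open import Data.Nat.DivMod using (m≡m%n+[m/n]*n; +-distrib-/-∣ʳ; m<n⇒m/n≡0; m*n/n≡m; [m+kn]%n≡m%n)
open import Data.Nat.Divisibility using (_∣_; divides; _∣?_; _∣0; 1∣_; ∣1⇒≡1; ∣-refl; n∣m*n; ∣m+n∣m⇒∣n; >⇒∤)
open import Data.Nat.Primality using (Prime; ¬prime[1]; euclidsLemma; prime⇒nonZero; prime⇒nonTrivial)
import Data.Nat.Properties as ℕₚ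
import Data.Nat.Tactic.RingSolver as ℕ-Solver
open import Data.Integer as ℤ using (ℤ; +_)
import Data.Integer.Divisibility.Signed as ℤˢ
import Data.Integer.Properties as ℤₚ
open import Data.Rational as ℚ using (ℚ; _+_; _*_; _-_; -_; 0ℚ; 1ℚ)
import Data.Rational.Properties as ℚₚ
import Data.Rational.Unnormalised as ℚᵘ
import Data.Rational.Unnormalised.Properties as ℚᵘₚ
open import Data.List using (foldr; applyUpTo)
open import Data.List.Properties using (map-applyUpTo)
open import Data.Maybe.Base using (just; nothing)
open import Data.Product using (_×_; _,_; ∃-syntax)
open import Data.Sum using (_⊎_; inj₁; inj₂; [_,_]′)
open import Function using (_∘_; id)
open import Level using (0ℓ)
open import Relation.Binary.PropositionalEquality
open import Relation.Nullary using (¬_; yes; no; contradiction)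
open import Tactic.RingSolver using (solve-∀)
import Tactic.RingSolver.Core.AlmostCommutativeRing as ACR

-- Write P = p ^ a = 2 n + 1, aₖ = binom(2k,k)² / 16ᵏ, S N = a₀ + … + a_N, and work modulo p³ in
-- the localization of ℤ at p, where P / i is divisible by p as soon as P ∤ i.
-- (1) For n < k < P, aₖ is P² / binom(n-1,k-n-1)² up to a factor ≡ 1 (mod p). Hence
--     p² ∣ aₖ, and aₖ ≡ aₗ when k + l = (3P - 1)/2. Folding the sum along this symmetry gives
--     2 S ⌊3P/4⌋ ≡ S n + S (P - 1), plus the central term a_⌊3P/4⌋ when P ≡ 3 (mod 4).
-- (2) S n comes from the exact identity
--     4ᴺ S N = (2N + 1) (binom(2N,N) / 4ᴺ) ∑_{l ≤ N} binom(2N+1,l) / (2N+1-2l).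
-- (3) For S (P - 1), put T k y = (-y)ₖ(1+y)ₖ / k!² = aₖ ∏_{j ≤ k} (1 - (2y+1)²/(2j-1)²). For k < P
--     and 2y + 1 ∈ P ℤ this is modulo p³ an affine function of (2y+1)², so S (P - 1) is
--     extrapolated from 2y + 1 = P and 2y + 1 = 3P. At these points the sum is computed from
--     ∑_{k ≤ N} (T k (y - 1) + T k y) = 2 ∏_{j ≤ N} (1 - y²/j²).
-- (4) Both values are expressed by sums of P²/j², and they combine to S n + S (P - 1) ≡ 2 (-1)ⁿ.
-- (5) For a ≥ 2 the central term vanishes modulo p³.

-- In (3), S (P - 1) is the sum of T k y at y = -1/2, which the recurrence with unit steps in y,
-- started at y = 0, never reaches. The integers n and P + n stand in for -1/2 because 2y + 1 is P
-- and 3P there; the weights 9/8 and -1/8 carry an affine function from the points 1 and 9 to 0.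
-- Affinity has two causes. For k ≤ n every factor is 1 minus a multiple of p², so products of
-- corrections drop out. For k > n the factor with 2j - 1 = P is not close to 1, but it is affine by
-- itself, and it alone matters modulo p, which suffices since p² ∣ aₖ. The obstacle in (1) is that
-- P may be a proper power of p: binom(n-1,i) can then be divisible by p, and P² / binom(n-1,i)² is
-- not visibly divisible by p². Leibniz's harmonic triangle settles this without counting
-- valuations. In (4) an alternating sum of P²/j² enters both values. It is never evaluated, because
-- it cancels.

ℚ-ring : ACR.AlmostCommutativeRing 0ℓ 0ℓ
ℚ-ring = ACR.fromCommutativeRing ℚₚ.+-*-commutativeRing 0≟
  where
  0≟ : ∀ x → _
  0≟ x with 0ℚ ℚ.≟ x
  ... | yes 0≡x = just 0≡x
  ... | no  _   = nothing

-- Equations are derived from hypotheses as explicit linear combinations, so that only a ring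
-- identity is left; a relation ι i * inv i ≡ 1ℚ is one of the hypotheses.
linear : ∀ {x y u v} c → u ≡ v → x - y ≡ c * (u - v) → x ≡ y
linear {x} {y} {u} c refl e = begin
  x               ≡⟨ split x y ⟩
  (x - y) + y     ≡⟨ cong (_+ y) e ⟩
  c * (u - u) + y ≡⟨ cancel c u y ⟩
  y               ∎
  where
  open ≡-Reasoning
  split : ∀ x y → x ≡ (x - y) + y
  split = solve-∀ ℚ-ring
  cancel : ∀ c u y → c * (u - u) + y ≡ y
  cancel = solve-∀ ℚ-ring

linear₂ : ∀ {x y u v u′ v′} c c′ → u ≡ v → u′ ≡ v′ →
          x - y ≡ c * (u - v) + c′ * (u′ - v′) → x ≡ y
linear₂ {u = u} {u′ = u′} c c′ refl refl e = linear 1ℚ (refl {x = u}) (trans e (lem c c′ u u′))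
  where
  lem : ∀ c c′ u u′ → c * (u - u) + c′ * (u′ - u′) ≡ 1ℚ * (u - u)
  lem = solve-∀ ℚ-ring

linear₃ : ∀ {x y u v u′ v′ u″ v″} c c′ c″ → u ≡ v → u′ ≡ v′ → u″ ≡ v″ →
          x - y ≡ c * (u - v) + c′ * (u′ - v′) + c″ * (u″ - v″) → x ≡ y
linear₃ {u = u} {u′ = u′} {u″ = u″} c c′ c″ refl refl refl e =
  linear 1ℚ (refl {x = u}) (trans e (lem c c′ c″ u u′ u″))
  where
  lem : ∀ c c′ c″ u u′ u″ → c * (u - u) + c′ * (u′ - u′) + c″ * (u″ - u″) ≡ 1ℚ * (u - u)
  lem = solve-∀ ℚ-ring

-- Integers, naturals and reciprocals in ℚ

private
  ℤtoℚᵘ : ∀ z → ℚ.toℚᵘ (ℤtoℚ z) ℚᵘ.≃ ℚᵘ.mkℚᵘ z 0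
  ℤtoℚᵘ z = ℚₚ.toℚᵘ-fromℚᵘ (ℚᵘ.mkℚᵘ z 0)

ℤtoℚ-+ : ∀ x y → ℤtoℚ (x ℤ.+ y) ≡ ℤtoℚ x + ℤtoℚ y
ℤtoℚ-+ x y = ℚₚ.toℚᵘ-injective (begin
  ℚ.toℚᵘ (ℤtoℚ (x ℤ.+ y))                       ≈⟨ ℤtoℚᵘ (x ℤ.+ y) ⟩
  ℚᵘ.mkℚᵘ (x ℤ.+ y) 0                           ≈⟨ ℚᵘ.*≡* (cong (ℤ._* + 1) (sym (cong₂ ℤ._+_ (ℤₚ.*-identityʳ x) (ℤₚ.*-identityʳ y)))) ⟩
  ℚᵘ.mkℚᵘ x 0 ℚᵘ.+ ℚᵘ.mkℚᵘ y 0                  ≈⟨ ℚᵘₚ.+-cong (ℤtoℚᵘ x) (ℤtoℚᵘ y) ⟨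
  ℚ.toℚᵘ (ℤtoℚ x) ℚᵘ.+ ℚ.toℚᵘ (ℤtoℚ y)          ≈⟨ ℚₚ.toℚᵘ-homo-+ (ℤtoℚ x) (ℤtoℚ y) ⟨
  ℚ.toℚᵘ (ℤtoℚ x + ℤtoℚ y)                      ∎)
  where open import Relation.Binary.Reasoning.Setoid ℚᵘₚ.≃-setoid

ℤtoℚ-* : ∀ x y → ℤtoℚ (x ℤ.* y) ≡ ℤtoℚ x * ℤtoℚ y
ℤtoℚ-* x y = ℚₚ.toℚᵘ-injective (begin
  ℚ.toℚᵘ (ℤtoℚ (x ℤ.* y))                       ≈⟨ ℤtoℚᵘ (x ℤ.* y) ⟩
  ℚᵘ.mkℚᵘ x 0 ℚᵘ.* ℚᵘ.mkℚᵘ y 0                  ≈⟨ ℚᵘₚ.*-cong (ℤtoℚᵘ x) (ℤtoℚᵘ y) ⟨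
  ℚ.toℚᵘ (ℤtoℚ x) ℚᵘ.* ℚ.toℚᵘ (ℤtoℚ y)          ≈⟨ ℚₚ.toℚᵘ-homo-* (ℤtoℚ x) (ℤtoℚ y) ⟨
  ℚ.toℚᵘ (ℤtoℚ x * ℤtoℚ y)                      ∎)
  where open import Relation.Binary.Reasoning.Setoid ℚᵘₚ.≃-setoid

ℤtoℚ-neg : ∀ x → ℤtoℚ (ℤ.- x) ≡ - ℤtoℚ x
ℤtoℚ-neg x = linear 1ℚ (sym (ℤtoℚ-+ x (ℤ.- x)))
  (trans (lem (ℤtoℚ (ℤ.- x)) (ℤtoℚ x))
         (cong (λ z → 1ℚ * (ℤtoℚ x + ℤtoℚ (ℤ.- x) - ℤtoℚ z)) (sym (ℤₚ.+-inverseʳ x))))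
  where
  lem : ∀ u v → u - - v ≡ 1ℚ * (v + u - 0ℚ)
  lem = solve-∀ ℚ-ring

-- ι and inv are abstract so that ℚ never computes with them.
abstract
  ι : ℕ → ℚ
  ι n = ℤtoℚ (+ n)

  inv : ℕ → ℚ
  inv = natFrac 1

  ι-def : ∀ n → ι n ≡ ℤtoℚ (+ n)
  ι-def n = refl

  ι-0 : ι 0 ≡ 0ℚ
  ι-0 = refl

  ι-1 : ι 1 ≡ 1ℚ
  ι-1 = refl

  ι-+ : ∀ m n → ι (m ℕ.+ n) ≡ ι m + ι n
  ι-+ m n = ℤtoℚ-+ (+ m) (+ n)

  ι-* : ∀ m n → ι (m ℕ.* n) ≡ ι m * ι n
  ι-* m n = trans (cong ℤtoℚ (ℤₚ.pos-* m n)) (ℤtoℚ-* (+ m) (+ n))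

  natFrac-ι : ∀ m d → natFrac m d ≡ ι m * inv d
  natFrac-ι m zero    = sym (ℚₚ.*-zeroʳ (ι m))
  natFrac-ι m (suc d) = ℚₚ.toℚᵘ-injective (begin
    ℚ.toℚᵘ (natFrac m (suc d))                    ≈⟨ ℚₚ.toℚᵘ-fromℚᵘ (ℚᵘ.mkℚᵘ (+ m) d) ⟩
    ℚᵘ.mkℚᵘ (+ m) d                               ≈⟨ ℚᵘ.*≡* (cong₂ ℤ._*_ (sym (ℤₚ.*-identityʳ (+ m))) (cong (λ e → + (suc e)) (ℕₚ.+-identityʳ d))) ⟩
    ℚᵘ.mkℚᵘ (+ m) 0 ℚᵘ.* ℚᵘ.mkℚᵘ (+ 1) d          ≈⟨ ℚᵘₚ.*-cong (ℤtoℚᵘ (+ m)) (ℚₚ.toℚᵘ-fromℚᵘ (ℚᵘ.mkℚᵘ (+ 1) d)) ⟨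
    ℚ.toℚᵘ (ι m) ℚᵘ.* ℚ.toℚᵘ (inv (suc d))        ≈⟨ ℚₚ.toℚᵘ-homo-* (ι m) (inv (suc d)) ⟨
    ℚ.toℚᵘ (ι m * inv (suc d))                    ∎)
    where open import Relation.Binary.Reasoning.Setoid ℚᵘₚ.≃-setoid

  ι-inv : ∀ n .{{_ : NonZero n}} → ι n * inv n ≡ 1ℚ
  ι-inv (suc n) = trans (sym (natFrac-ι (suc n) (suc n)))
    (ℚₚ.fromℚᵘ-cong {ℚᵘ.mkℚᵘ (+ suc n) n} {ℚᵘ.mkℚᵘ (+ 1) 0}
      (ℚᵘ.*≡* (trans (ℤₚ.*-identityʳ (+ suc n)) (sym (ℤₚ.*-identityˡ (+ suc n))))))

ι-suc : ∀ n → ι (suc n) ≡ 1ℚ + ι n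
ι-suc n = trans (ι-+ 1 n) (cong (_+ ι n) ι-1)

ι-2* : ∀ n → ι (2 ℕ.* n) ≡ ι n + ι n
ι-2* n = trans (ι-+ n (n ℕ.+ 0)) (cong (λ m → ι n + ι m) (ℕₚ.+-identityʳ n))

*-cancelˡ-ι : ∀ n .{{_ : NonZero n}} {x y} → ι n * x ≡ ι n * y → x ≡ y
*-cancelˡ-ι n {x} {y} e = linear₂ (inv n) (- (x - y)) e (ι-inv n) (lem (ι n) (inv n) x y)
  where
  lem : ∀ d i x y → x - y ≡ i * (d * x - d * y) + - (x - y) * (d * i - 1ℚ)
  lem = solve-∀ ℚ-ring

inv-unique : ∀ n .{{_ : NonZero n}} {x} → ι n * x ≡ 1ℚ → x ≡ inv n
inv-unique n e = *-cancelˡ-ι n (trans e (sym (ι-inv n)))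

inv-1 : inv 1 ≡ 1ℚ
inv-1 = sym (inv-unique 1 (trans (cong (_* 1ℚ) ι-1) refl))

inv-* : ∀ m n .{{_ : NonZero m}} .{{_ : NonZero n}} → inv (m ℕ.* n) ≡ inv m * inv n
inv-* m n = sym (inv-unique (m ℕ.* n) {{ℕₚ.m*n≢0 m n}} (trans (cong (_* (inv m * inv n)) (ι-* m n))
  (linear₂ (ι n * inv n) 1ℚ (ι-inv m) (ι-inv n) (lem (ι m) (inv m) (ι n) (inv n)))))
  where
  lem : ∀ m i n j → m * n * (i * j) - 1ℚ ≡ n * j * (m * i - 1ℚ) + 1ℚ * (n * j - 1ℚ)
  lem = solve-∀ ℚ-ring

-- Finite sums and signs

-- The last summand is split off, so that a sum unfolds along with recursions in its upper bound;
-- `sumTo` folds from the other end.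
∑ : ℕ → (ℕ → ℚ) → ℚ
∑ zero    f = 0ℚ
∑ (suc n) f = ∑ n f + f n

∑-cong : ∀ n {f g} → (∀ i → i < n → f i ≡ g i) → ∑ n f ≡ ∑ n g
∑-cong zero    e = refl
∑-cong (suc n) e = cong₂ _+_ (∑-cong n (λ i i<n → e i (ℕₚ.m<n⇒m<1+n i<n))) (e n ℕₚ.≤-refl)

∑-+ : ∀ n f g → ∑ n (λ i → f i + g i) ≡ ∑ n f + ∑ n g
∑-+ zero    f g = refl
∑-+ (suc n) f g = trans (cong (_+ (f n + g n)) (∑-+ n f g)) (lem (∑ n f) (∑ n g) (f n) (g n))
  where
  lem : ∀ a b c d → a + b + (c + d) ≡ a + c + (b + d)
  lem = solve-∀ ℚ-ring

∑-* : ∀ n c f → ∑ n (λ i → c * f i) ≡ c * ∑ n f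
∑-* zero    c f = sym (ℚₚ.*-zeroʳ c)
∑-* (suc n) c f = trans (cong (_+ c * f n) (∑-* n c f)) (sym (ℚₚ.*-distribˡ-+ c (∑ n f) (f n)))

∑-split : ∀ m n f → ∑ (m ℕ.+ n) f ≡ ∑ m f + ∑ n (λ i → f (m ℕ.+ i))
∑-split m zero    f = trans (cong (λ k → ∑ k f) (ℕₚ.+-identityʳ m)) (sym (ℚₚ.+-identityʳ (∑ m f)))
∑-split m (suc n) f = trans (cong (λ k → ∑ k f) (ℕₚ.+-suc m n))
  (trans (cong (_+ f (m ℕ.+ n)) (∑-split m n f)) (ℚₚ.+-assoc (∑ m f) (∑ n (λ i → f (m ℕ.+ i))) (f (m ℕ.+ n))))

∑-head : ∀ n f → ∑ (suc n) f ≡ f 0 + ∑ n (f ∘ suc)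
∑-head n f = trans (∑-split 1 n f) (cong (_+ ∑ n (f ∘ suc)) (ℚₚ.+-identityˡ (f 0)))

∑-reverse : ∀ n f → ∑ n f ≡ ∑ n (λ i → f (n ∸ suc i))
∑-reverse zero    f = refl
∑-reverse (suc n) f = begin
  ∑ n f + f n                              ≡⟨ cong (_+ f n) (∑-reverse n f) ⟩
  ∑ n (λ i → f (n ∸ suc i)) + f n          ≡⟨ ℚₚ.+-comm _ (f n) ⟩
  f n + ∑ n (λ i → f (n ∸ suc i))          ≡⟨ ∑-head n (λ i → f (n ∸ i)) ⟨
  ∑ (suc n) (λ i → f (n ∸ i))              ∎
  where open ≡-Reasoning

sumTo-∑ : ∀ N f → sumTo N f ≡ ∑ (suc N) f
sumTo-∑ N f = trans (cong (foldr _+_ 0ℚ) (map-applyUpTo id f (suc N))) (go (suc N) f)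
  where
  go : ∀ n f → foldr _+_ 0ℚ (applyUpTo f n) ≡ ∑ n f
  go zero    f = refl
  go (suc n) f = trans (cong (λ s → f 0 + s) (go n (f ∘ suc))) (sym (∑-head n f))

sign : ℕ → ℚ
sign zero    = 1ℚ
sign (suc n) = - sign n

sign-+ : ∀ m n → sign (m ℕ.+ n) ≡ sign m * sign n
sign-+ zero    n = sym (ℚₚ.*-identityˡ (sign n))
sign-+ (suc m) n = trans (cong -_ (sign-+ m n)) (ℚₚ.neg-distribˡ-* (sign m) (sign n))

sign² : ∀ n → sign n * sign n ≡ 1ℚ
sign² zero    = refl
sign² (suc n) = trans (lem (sign n)) (sign² n)
  where
  lem : ∀ s → - s * - s ≡ s * s
  lem = solve-∀ ℚ-ring

sign-even : ∀ n → sign (2 ℕ.* n) ≡ 1ℚ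
sign-even n = trans (cong (λ m → sign (n ℕ.+ m)) (ℕₚ.+-identityʳ n)) (trans (sign-+ n n) (sign² n))

-- Binomial coefficients as rationals

binom : ℕ → ℕ → ℚ
binom n k = ι (n C k)

binom-0 : ∀ n → binom n 0 ≡ 1ℚ
binom-0 n = ι-1

binom-> : ∀ {n k} → n < k → binom n k ≡ 0ℚ
binom-> n<k = trans (cong ι (k>n⇒nCk≡0 n<k)) ι-0

binom-Pascal : ∀ n k → binom (suc n) (suc k) ≡ binom n k + binom n (suc k)
binom-Pascal n k = trans (cong ι (sym (nCk+nC[k+1]≡[n+1]C[k+1] n k))) (ι-+ (n C k) (n C suc k))

-- The difference is taken in ℚ, where nothing is truncated, so the ratio rule also covers k ≥ n.
binom-step : ∀ n k → ι (suc k) * binom n (suc k) ≡ (ι n - ι k) * binom n k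
binom-step zero zero = trans (cong (ι 1 *_) (binom-> {0} {1} (s≤s z≤n))) (lem (ι 1) (ι 0) (binom 0 0))
  where
  lem : ∀ x y z → x * 0ℚ ≡ (y - y) * z
  lem = solve-∀ ℚ-ring
binom-step zero (suc k) = begin
  ι (suc (suc k)) * binom 0 (suc (suc k)) ≡⟨ cong (ι (suc (suc k)) *_) (binom-> {0} {suc (suc k)} (s≤s z≤n)) ⟩
  ι (suc (suc k)) * 0ℚ                    ≡⟨ lem (ι (suc (suc k))) (ι 0 - ι (suc k)) ⟩
  (ι 0 - ι (suc k)) * 0ℚ                  ≡⟨ cong ((ι 0 - ι (suc k)) *_) (binom-> {0} {suc k} (s≤s z≤n)) ⟨
  (ι 0 - ι (suc k)) * binom 0 (suc k)     ∎
  where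
  open ≡-Reasoning
  lem : ∀ x y → x * 0ℚ ≡ y * 0ℚ
  lem = solve-∀ ℚ-ring
binom-step (suc n) k = begin
  ι (suc k) * binom (suc n) (suc k)   ≡⟨ cong (ι (suc k) *_) (binom-Pascal n k) ⟩
  ι (suc k) * (binom n k + binom n (suc k)) ≡⟨ linear₂ 1ℚ (binom n k) (binom-step n k) (ι-suc k) (lem₁ (ι k) (ι (suc k)) (ι n) (binom n k) (binom n (suc k))) ⟩
  (1ℚ + ι n) * binom n k              ≡⟨ upper k ⟩
  (ι (suc n) - ι k) * binom (suc n) k ∎
  where
  open ≡-Reasoning
  lem₁ : ∀ k k′ n b b′ → k′ * (b + b′) - (1ℚ + n) * b ≡ 1ℚ * (k′ * b′ - (n - k) * b) + b * (k′ - (1ℚ + k))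
  lem₁ = solve-∀ ℚ-ring
  -- For a positive lower index this reduces through Pascal's rule to the same ratio rule in row n.
  upper : ∀ k → (1ℚ + ι n) * binom n k ≡ (ι (suc n) - ι k) * binom (suc n) k
  upper zero = trans (cong₂ _*_ (sym (ι-suc n)) refl) (trans (lem (ι (suc n)) (binom n 0)) (cong₂ (λ u v → (ι (suc n) - u) * v) (sym ι-0) (trans (binom-0 n) (sym (binom-0 (suc n))))))
    where
    lem : ∀ x y → x * y ≡ (x - 0ℚ) * y
    lem = solve-∀ ℚ-ring
  upper (suc k) rewrite ι-suc n | binom-Pascal n k = linear₂ 1ℚ (binom n k) (binom-step n k) (ι-suc k)
    (lem (ι n) (ι k) (ι (suc k)) (binom n k) (binom n (suc k)))
    where
    lem : ∀ n k k′ b b′ → (1ℚ + n) * b′ - (1ℚ + n - k′) * (b + b′) ≡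
                          1ℚ * (k′ * b′ - (n - k) * b) + b * (k′ - (1ℚ + k))
    lem = solve-∀ ℚ-ring

binom-absorb : ∀ n k → ι (suc k) * binom (suc n) (suc k) ≡ ι (suc n) * binom n k
binom-absorb n k rewrite binom-Pascal n k | ι-suc n = linear₂ 1ℚ (binom n k) (binom-step n k) (ι-suc k)
  (lem (ι n) (ι k) (ι (suc k)) (binom n k) (binom n (suc k)))
  where
  lem : ∀ n k k′ b b′ → k′ * (b + b′) - (1ℚ + n) * b ≡ 1ℚ * (k′ * b′ - (n - k) * b) + b * (k′ - (1ℚ + k))
  lem = solve-∀ ℚ-ring

nCk≢0 : ∀ {n k} → k ≤ n → NonZero (n C k)
nCk≢0 {n} {zero} _ = _
nCk≢0 {suc n} {suc k} (s≤s k≤n) = subst NonZero (nCk+nC[k+1]≡[n+1]C[k+1] n k)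
  (ℕ.>-nonZero (ℕₚ.<-≤-trans (ℕ.>-nonZero⁻¹ (n C k) {{nCk≢0 k≤n}}) (ℕₚ.m≤m+n (n C k) (n C suc k))))

-- Divisibility and congruence in the localization at p

module Localization (p : ℕ) (p-prime : Prime p) where

  instance
    p≢0 : NonZero p
    p≢0 = prime⇒nonZero p-prime

  -- p ^ e divides x in the localization of ℤ at p
  record Div (e : ℕ) (x : ℚ) : Set where
    constructor mkDiv
    field
      num   : ℤ
      den   : ℕ
      p∤den : ¬ (p ∣ den)
      eqn   : ι den * x ≡ ι (p ^ e) * ℤtoℚ num

  p∤1 : ¬ (p ∣ 1)
  p∤1 p∣1 = ℕ.nonTrivial⇒≢1 {{prime⇒nonTrivial p-prime}} (∣1⇒≡1 p∣1)

  p∤* : ∀ {b c} → ¬ (p ∣ b) → ¬ (p ∣ c) → ¬ (p ∣ b ℕ.* c)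
  p∤* {b} {c} p∤b p∤c = [ p∤b , p∤c ]′ ∘ euclidsLemma b c p-prime

  p∤^ : ∀ {b} k → ¬ (p ∣ b) → ¬ (p ∣ b ^ k)
  p∤^ zero    p∤b = p∤1
  p∤^ (suc k) p∤b = p∤* p∤b (p∤^ k p∤b)

  Div-+ : ∀ {e x y} → Div e x → Div e y → Div e (x + y)
  Div-+ {e} {x} {y} (mkDiv a b p∤b e₁) (mkDiv a′ b′ p∤b′ e₂) =
    mkDiv (+ b′ ℤ.* a ℤ.+ + b ℤ.* a′) (b ℕ.* b′) (p∤* p∤b p∤b′) (begin
      ι (b ℕ.* b′) * (x + y)                               ≡⟨ cong (_* (x + y)) (ι-* b b′) ⟩
      ι b * ι b′ * (x + y)                                 ≡⟨ linear₂ (ι b′) (ι b) e₁ e₂ (lem (ι b) (ι b′) x y (ι (p ^ e)) (ℤtoℚ a) (ℤtoℚ a′)) ⟩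
      ι (p ^ e) * (ι b′ * ℤtoℚ a + ι b * ℤtoℚ a′)          ≡⟨ cong (ι (p ^ e) *_) (cong₂ _+_ (ιℤ b′ a) (ιℤ b a′)) ⟩
      ι (p ^ e) * (ℤtoℚ (+ b′ ℤ.* a) + ℤtoℚ (+ b ℤ.* a′))  ≡⟨ cong (ι (p ^ e) *_) (ℤtoℚ-+ (+ b′ ℤ.* a) (+ b ℤ.* a′)) ⟨
      ι (p ^ e) * ℤtoℚ (+ b′ ℤ.* a ℤ.+ + b ℤ.* a′)         ∎)
    where
    open ≡-Reasoning
    ιℤ : ∀ n z → ι n * ℤtoℚ z ≡ ℤtoℚ (+ n ℤ.* z)
    ιℤ n z = trans (cong (_* ℤtoℚ z) (ι-def n)) (sym (ℤtoℚ-* (+ n) z))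
    lem : ∀ b b′ x y q a a′ → b * b′ * (x + y) - q * (b′ * a + b * a′) ≡ b′ * (b * x - q * a) + b * (b′ * y - q * a′)
    lem = solve-∀ ℚ-ring

  Div-* : ∀ {e f x y} → Div e x → Div f y → Div (e ℕ.+ f) (x * y)
  Div-* {e} {f} {x} {y} (mkDiv a b p∤b e₁) (mkDiv a′ b′ p∤b′ e₂) =
    mkDiv (a ℤ.* a′) (b ℕ.* b′) (p∤* p∤b p∤b′) (begin
      ι (b ℕ.* b′) * (x * y)                       ≡⟨ cong (_* (x * y)) (ι-* b b′) ⟩
      ι b * ι b′ * (x * y)                         ≡⟨ lem (ι b) (ι b′) x y ⟩
      (ι b * x) * (ι b′ * y)                       ≡⟨ cong₂ _*_ e₁ e₂ ⟩
      (ι (p ^ e) * ℤtoℚ a) * (ι (p ^ f) * ℤtoℚ a′) ≡⟨ lem (ι (p ^ e)) (ι (p ^ f)) (ℤtoℚ a) (ℤtoℚ a′) ⟨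
      (ι (p ^ e) * ι (p ^ f)) * (ℤtoℚ a * ℤtoℚ a′) ≡⟨ cong₂ _*_ (trans (cong ι (ℕₚ.^-distribˡ-+-* p e f)) (ι-* (p ^ e) (p ^ f))) (ℤtoℚ-* a a′) ⟨
      ι (p ^ (e ℕ.+ f)) * ℤtoℚ (a ℤ.* a′)          ∎)
    where
    open ≡-Reasoning
    lem : ∀ b c x y → b * c * (x * y) ≡ (b * x) * (c * y)
    lem = solve-∀ ℚ-ring

  Div-p^ : ∀ e → Div e (ι (p ^ e))
  Div-p^ e = mkDiv (+ 1) 1 p∤1 (trans (cong (_* ι (p ^ e)) ι-1) (ℚₚ.*-comm 1ℚ (ι (p ^ e))))

  Div-ℤ : ∀ z → Div 0 (ℤtoℚ z)
  Div-ℤ z = mkDiv z 1 p∤1 refl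

  Div-ι : ∀ n → Div 0 (ι n)
  Div-ι n = subst (Div 0) (sym (ι-def n)) (Div-ℤ (+ n))

  Div-1 : Div 0 1ℚ
  Div-1 = Div-ℤ (+ 1)

  Div-0 : ∀ {e} → Div e 0ℚ
  Div-0 {e} = mkDiv (+ 0) 1 p∤1 (trans (ℚₚ.*-zeroʳ (ι 1)) (sym (ℚₚ.*-zeroʳ (ι (p ^ e)))))

  Div-inv : ∀ {d} → ¬ (p ∣ d) → Div 0 (inv d)
  Div-inv {zero}  p∤d = contradiction (p ∣0) p∤d
  Div-inv {suc d} p∤d = mkDiv (+ 1) (suc d) p∤d (trans (ι-inv (suc d)) (sym (trans (cong (_* 1ℚ) ι-1) refl)))

  Div-scale : ∀ {e c x} → Div 0 c → Div e x → Div e (c * x)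
  Div-scale = Div-* {0}

  Div-neg : ∀ {e x} → Div e x → Div e (- x)
  Div-neg {e} {x} d = subst (Div e) (lem x) (Div-scale (Div-ℤ (ℤ.- + 1)) d)
    where
    lem : ∀ x → - 1ℚ * x ≡ - x
    lem = solve-∀ ℚ-ring

  Div-- : ∀ {e x y} → Div e x → Div e y → Div e (x - y)
  Div-- dx dy = Div-+ dx (Div-neg dy)

  Div-pred : ∀ {e x} → Div (suc e) x → Div e x
  Div-pred {e} {x} (mkDiv a b p∤b e₁) = mkDiv (+ p ℤ.* a) b p∤b (begin
    ι b * x                          ≡⟨ e₁ ⟩
    ι (p ℕ.* p ^ e) * ℤtoℚ a         ≡⟨ cong (_* ℤtoℚ a) (ι-* p (p ^ e)) ⟩
    ι p * ι (p ^ e) * ℤtoℚ a         ≡⟨ lem (ι p) (ι (p ^ e)) (ℤtoℚ a) ⟩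
    ι (p ^ e) * (ι p * ℤtoℚ a)       ≡⟨ cong (ι (p ^ e) *_) (trans (cong (_* ℤtoℚ a) (ι-def p)) (sym (ℤtoℚ-* (+ p) a))) ⟩
    ι (p ^ e) * ℤtoℚ (+ p ℤ.* a)     ∎)
    where
    open ≡-Reasoning
    lem : ∀ x y z → x * y * z ≡ y * (x * z)
    lem = solve-∀ ℚ-ring

  Div-∑ : ∀ {e} n {f} → (∀ i → i < n → Div e (f i)) → Div e (∑ n f)
  Div-∑ {e} zero    d = Div-0
  Div-∑ {e} (suc n) d = Div-+ (Div-∑ n (λ i i<n → d i (ℕₚ.m<n⇒m<1+n i<n))) (d n ℕₚ.≤-refl)

  Div-sign : ∀ n → Div 0 (sign n)
  Div-sign zero    = Div-1
  Div-sign (suc n) = Div-neg (Div-sign n)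

  -- A record and not a synonym for `Div e (x - y)`, so that both sides can be inferred from the
  -- type.
  record Cong (e : ℕ) (x y : ℚ) : Set where
    constructor cong-by
    field
      diff : Div e (x - y)
  open Cong public

  Cong⇒modℚ : ∀ {e x y} → Cong e x y → x ≡ y [modℚ p ^ e ]
  Cong⇒modℚ {e} {x} {y} (cong-by (mkDiv num den p∤den eq)) = num , den , p∤den ,
    trans (cong (_* (x - y)) (sym (ι-def den))) (trans eq (cong (_* ℤtoℚ num) (ι-def (p ^ e))))

  by-diff : ∀ {e x y z} → z ≡ x - y → Div e z → Cong e x y
  by-diff eq d = cong-by (subst (Div _) eq d)

  Cong-reflexive : ∀ {e x y} → x ≡ y → Cong e x y
  Cong-reflexive {x = x} refl = by-diff (sym (ℚₚ.+-inverseʳ x)) Div-0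

  Cong-refl : ∀ {e x} → Cong e x x
  Cong-refl = Cong-reflexive refl

  Cong-sym : ∀ {e x y} → Cong e x y → Cong e y x
  Cong-sym {e} {x} {y} c = by-diff (lem x y) (Div-neg (diff c))
    where
    lem : ∀ x y → - (x - y) ≡ y - x
    lem = solve-∀ ℚ-ring

  Cong-trans : ∀ {e x y z} → Cong e x y → Cong e y z → Cong e x z
  Cong-trans {e} {x} {y} {z} c c′ = by-diff (lem x y z) (Div-+ (diff c) (diff c′))
    where
    lem : ∀ x y z → (x - y) + (y - z) ≡ x - z
    lem = solve-∀ ℚ-ring

  Cong-+ : ∀ {e x y x′ y′} → Cong e x y → Cong e x′ y′ → Cong e (x + x′) (y + y′)
  Cong-+ {e} {x} {y} {x′} {y′} c c′ = by-diff (lem x y x′ y′) (Div-+ (diff c) (diff c′))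
    where
    lem : ∀ x y x′ y′ → (x - y) + (x′ - y′) ≡ x + x′ - (y + y′)
    lem = solve-∀ ℚ-ring

  Cong-scale : ∀ {e c x y} → Div 0 c → Cong e x y → Cong e (c * x) (c * y)
  Cong-scale {e} {c} {x} {y} dc d = by-diff (lem c x y) (Div-scale dc (diff d))
    where
    lem : ∀ c x y → c * (x - y) ≡ c * x - c * y
    lem = solve-∀ ℚ-ring

  Cong-∑ : ∀ {e} n {f g} → (∀ i → i < n → Cong e (f i) (g i)) → Cong e (∑ n f) (∑ n g)
  Cong-∑ zero    c = Cong-refl
  Cong-∑ (suc n) c = Cong-+ (Cong-∑ n (λ i i<n → c i (ℕₚ.m<n⇒m<1+n i<n))) (c n ℕₚ.≤-refl)

  Cong-pred : ∀ {e x y} → Cong (suc e) x y → Cong e x y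
  Cong-pred c = cong-by (Div-pred (diff c))

  Div-resp-Cong : ∀ {e x y} → Cong e x y → Div e y → Div e x
  Div-resp-Cong {e} {x} {y} c d = subst (Div e) (lem x y) (Div-+ (diff c) d)
    where
    lem : ∀ x y → (x - y) + y ≡ x
    lem = solve-∀ ℚ-ring

  ≡1⇒Div0 : ∀ {u} → Cong 1 u 1ℚ → Div 0 u
  ≡1⇒Div0 c = Div-resp-Cong (Cong-pred c) Div-1

  ≡1-* : ∀ {u v} → Cong 1 u 1ℚ → Cong 1 v 1ℚ → Cong 1 (u * v) 1ℚ
  ≡1-* {u} {v} du dv = by-diff (lem u v) (Div-+ (Div-* (diff du) (≡1⇒Div0 dv)) (diff dv))
    where
    lem : ∀ u v → (u - 1ℚ) * v + (v - 1ℚ) ≡ u * v - 1ℚ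
    lem = solve-∀ ℚ-ring

  -- equality up to a factor congruent to 1 modulo p
  infix 4 _~_
  record _~_ (x y : ℚ) : Set where
    constructor mk~
    field
      {u v} : ℚ
      u≡1   : Cong 1 u 1ℚ
      v≡1   : Cong 1 v 1ℚ
      xu≡yv : x * u ≡ y * v

  ~-reflexive : ∀ {x y} → x ≡ y → x ~ y
  ~-reflexive {x} refl = mk~ {u = 1ℚ} Cong-refl Cong-refl refl

  ~-trans : ∀ {x y z} → x ~ y → y ~ z → x ~ z
  ~-trans {x} {y} {z} (mk~ {u} {v} du dv e) (mk~ {u′} {v′} du′ dv′ e′) =
    mk~ (≡1-* du du′) (≡1-* dv dv′) (linear₂ u′ v e e′ (lem x y z u v u′ v′))
    where
    lem : ∀ x y z u v u′ v′ → x * (u * u′) - z * (v * v′) ≡ u′ * (x * u - y * v) + v * (y * u′ - z * v′)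
    lem = solve-∀ ℚ-ring

  ~-* : ∀ {x y x′ y′} → x ~ y → x′ ~ y′ → x * x′ ~ y * y′
  ~-* {x} {y} {x′} {y′} (mk~ {u} {v} du dv e) (mk~ {u′} {v′} du′ dv′ e′) =
    mk~ (≡1-* du du′) (≡1-* dv dv′)
    (trans (lem x x′ u u′) (trans (cong₂ _*_ e e′) (sym (lem y y′ v v′))))
    where
    lem : ∀ x x′ u u′ → x * x′ * (u * u′) ≡ (x * u) * (x′ * u′)
    lem = solve-∀ ℚ-ring

  ~-cancelˡ-ι : ∀ c .{{_ : NonZero c}} {x y} → ι c * x ~ ι c * y → x ~ y
  ~-cancelˡ-ι c {x} {y} (mk~ {u} {v} du dv e) = mk~ du dv
    (*-cancelˡ-ι c (trans (sym (ℚₚ.*-assoc (ι c) x u)) (trans e (ℚₚ.*-assoc (ι c) y v))))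

  -- By xu = yv the difference x - y equals (v - 1) y - (u - 1) x, and each product gains one p.
  -- This gain lets squares divisible by p² be compared modulo p³ while each is known only up to a
  -- factor ≡ 1 (mod p).
  ~⇒Cong : ∀ {e x y} → Div e x → Div e y → x ~ y → Cong (suc e) x y
  ~⇒Cong {e} {x} {y} dx dy (mk~ {u} {v} du dv eq) = by-diff (sym expand)
    (Div-- (Div-* (diff dv) dy) (Div-* (diff du) dx))
    where
    lem : ∀ x y u v → (x - y) - ((v - 1ℚ) * y - (u - 1ℚ) * x) ≡ 1ℚ * (x * u - y * v)
    lem = solve-∀ ℚ-ring
    expand : x - y ≡ (v - 1ℚ) * y - (u - 1ℚ) * x
    expand = linear 1ℚ eq (lem x y u v)

  -- If u - 1 = p a / b, then b u is the integer w = b + p a, which is prime to p; so w can join the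
  -- denominator of x u.
  Div-cancel-unit : ∀ {e x u} → Cong 1 u 1ℚ → Div e (x * u) → Div e x
  Div-cancel-unit {e} {x} {u} du@(cong-by (mkDiv a b p∤b e₁)) (mkDiv a′ b′ p∤b′ e₂) = result w refl p∤∣w∣
    where
    open ≡-Reasoning
    w : ℤ
    w = + b ℤ.+ + p ℤ.* a
    bu : ι b * u ≡ ℤtoℚ w
    bu = begin
      ι b * u                                    ≡⟨ linear 1ℚ e₁ (lem (ι b) u (ι (p ^ 1)) (ℤtoℚ a)) ⟩
      ι b + ι (p ^ 1) * ℤtoℚ a                   ≡⟨ cong₂ (λ s t → s + t * ℤtoℚ a) (ι-def b) (trans (cong ι (ℕₚ.^-identityʳ p)) (ι-def p)) ⟩
      ℤtoℚ (+ b) + ℤtoℚ (+ p) * ℤtoℚ a           ≡⟨ cong (λ s → ℤtoℚ (+ b) + s) (ℤtoℚ-* (+ p) a) ⟨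
      ℤtoℚ (+ b) + ℤtoℚ (+ p ℤ.* a)              ≡⟨ ℤtoℚ-+ (+ b) (+ p ℤ.* a) ⟨
      ℤtoℚ w                                     ∎
      where
      lem : ∀ b u q a → b * u - (b + q * a) ≡ 1ℚ * (b * (u - 1ℚ) - q * a)
      lem = solve-∀ ℚ-ring
    p∤∣w∣ : ¬ (p ∣ ℤ.∣ w ∣)
    p∤∣w∣ p∣w = p∤b (ℤˢ.∣⇒∣ᵤ {+ p} {+ b}
      (ℤˢ.∣m+n∣m⇒∣n {+ p} {+ p ℤ.* a} {+ b} (subst (+ p ℤˢ.∣_) (ℤₚ.+-comm (+ b) (+ p ℤ.* a)) (ℤˢ.∣ᵤ⇒∣ {+ p} {w} p∣w))
        (ℤˢ.divides a (ℤₚ.*-comm (+ p) a))))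
    eqn : ι b′ * ℤtoℚ w * x ≡ ι (p ^ e) * (ι b * ℤtoℚ a′)
    eqn = linear₂ (ι b) (- (ι b′ * x)) e₂ bu (lem (ι b) (ι b′) (ℤtoℚ w) x u (ι (p ^ e)) (ℤtoℚ a′))
      where
      lem : ∀ b b′ w x u q a → b′ * w * x - q * (b * a) ≡ b * (b′ * (x * u) - q * a) + - (b′ * x) * (b * u - w)
      lem = solve-∀ ℚ-ring
    ba′ : ι b * ℤtoℚ a′ ≡ ℤtoℚ (+ b ℤ.* a′)
    ba′ = trans (cong (_* ℤtoℚ a′) (ι-def b)) (sym (ℤtoℚ-* (+ b) a′))
    -- Denominators are natural numbers, so a negative w passes its sign to the numerator.
    result : ∀ z → z ≡ w → ¬ (p ∣ ℤ.∣ z ∣) → Div e x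
    result (+ m) eq p∤m = mkDiv (+ b ℤ.* a′) (b′ ℕ.* m) (p∤* p∤b′ p∤m) (begin
      ι (b′ ℕ.* m) * x               ≡⟨ cong (_* x) (trans (ι-* b′ m) (cong (ι b′ *_) (trans (ι-def m) (cong ℤtoℚ eq)))) ⟩
      ι b′ * ℤtoℚ w * x              ≡⟨ eqn ⟩
      ι (p ^ e) * (ι b * ℤtoℚ a′)    ≡⟨ cong (ι (p ^ e) *_) ba′ ⟩
      ι (p ^ e) * ℤtoℚ (+ b ℤ.* a′)  ∎)
    result (ℤ.-[1+ m ]) eq p∤m = mkDiv (ℤ.- (+ b ℤ.* a′)) (b′ ℕ.* suc m) (p∤* p∤b′ p∤m) (begin
      ι (b′ ℕ.* suc m) * x                 ≡⟨ cong (_* x) (trans (ι-* b′ (suc m)) (cong (ι b′ *_) (trans (ι-def (suc m)) (ℤtoℚ-neg (ℤ.-[1+ m ]))))) ⟩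
      ι b′ * - ℤtoℚ (ℤ.-[1+ m ]) * x       ≡⟨ cong (λ z → ι b′ * - ℤtoℚ z * x) eq ⟩
      ι b′ * - ℤtoℚ w * x                  ≡⟨ linear (- 1ℚ) eqn (lem (ι b′) (ℤtoℚ w) x (ι (p ^ e)) (ι b * ℤtoℚ a′)) ⟩
      ι (p ^ e) * - (ι b * ℤtoℚ a′)        ≡⟨ cong (λ z → ι (p ^ e) * - z) ba′ ⟩
      ι (p ^ e) * - ℤtoℚ (+ b ℤ.* a′)      ≡⟨ cong (ι (p ^ e) *_) (ℤtoℚ-neg (+ b ℤ.* a′)) ⟨
      ι (p ^ e) * ℤtoℚ (ℤ.- (+ b ℤ.* a′))  ∎)
      where
      lem : ∀ b w x q c → b * - w * x - q * - c ≡ - 1ℚ * (b * w * x - q * c)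
      lem = solve-∀ ℚ-ring

  Div-resp-~ : ∀ {e x y} → x ~ y → Div e y → Div e x
  Div-resp-~ {e} {x} {y} (mk~ {u} {v} du dv eq) dy = Div-cancel-unit du
    (subst (Div e) (trans (ℚₚ.*-comm v y) (sym eq)) (Div-scale (≡1⇒Div0 dv) dy))

  -- Common factors p of p ^ a and i are cancelled one at a time. The hypothesis prevents p ^ a from
  -- being used up first, so at least one p is left when i has become prime to p.
  Div-p^a/i : ∀ a {i} → ¬ (p ^ a ∣ i) → Div 1 (ι (p ^ a) * inv i)
  Div-p^a/i zero {i} ∤i = contradiction (1∣ i) ∤i
  Div-p^a/i (suc a) {i} ∤i with p ∣? i
  ... | no p∤i = Div-* {1} {0} (subst (Div 1) (sym (ι-* p (p ^ a))) (Div-* {1} {0} Div-p (Div-ι (p ^ a)))) (Div-inv p∤i)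
    where
    Div-p : Div 1 (ι p)
    Div-p = subst (Div 1) (cong ι (ℕₚ.^-identityʳ p)) (Div-p^ 1)
  ... | yes (divides zero refl) = contradiction ((p ^ suc a) ∣0) ∤i
  ... | yes (divides (suc q) refl) = subst (Div 1) (sym eq) (Div-p^a/i a {suc q} ∤q)
    where
    ∤q : ¬ (p ^ a ∣ suc q)
    ∤q (divides r e) = ∤i (divides r (trans (cong (ℕ._* p) e) (trans (ℕₚ.*-assoc r (p ^ a) p) (cong (r ℕ.*_) (ℕₚ.*-comm (p ^ a) p)))))
    lem : ∀ p P j q → p * P * (q * j) - P * q ≡ P * q * (p * j - 1ℚ)
    lem = solve-∀ ℚ-ring
    eq : ι (p ^ suc a) * inv (suc q ℕ.* p) ≡ ι (p ^ a) * inv (suc q)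
    eq = trans (cong₂ _*_ (ι-* p (p ^ a)) (inv-* (suc q) p))
      (linear (ι (p ^ a) * inv (suc q)) (ι-inv p) (lem (ι p) (ι (p ^ a)) (inv p) (inv (suc q))))

-- Central binomial coefficients over powers of 4

2*-suc : ∀ k → 2 ℕ.* suc k ≡ suc (suc (2 ℕ.* k))
2*-suc k = ℕₚ.*-suc 2 k

ι-odd : ∀ k → ι (suc (2 ℕ.* k)) ≡ 1ℚ + (ι k + ι k)
ι-odd k = trans (ι-suc (2 ℕ.* k)) (cong (λ x → 1ℚ + x) (ι-2* k))

inv-half : ∀ k → inv (suc k) ≡ inv (2 ℕ.* suc k) + inv (2 ℕ.* suc k)
inv-half k = sym (inv-unique (suc k) (trans (lem (ι (suc k)) (inv (2 ℕ.* suc k)))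
  (trans (cong (_* inv (2 ℕ.* suc k)) (sym (ι-2* (suc k)))) (ι-inv (2 ℕ.* suc k)))))
  where
  lem : ∀ x j → x * (j + j) ≡ (x + x) * j
  lem = solve-∀ ℚ-ring

-- b k = binom (2 k) k / 4 ^ k
b : ℕ → ℚ
b zero    = 1ℚ
b (suc k) = b k * (ι (suc (2 ℕ.* k)) * inv (2 ℕ.* suc k))

b-suc : ∀ k → ι (2 ℕ.* suc k) * b (suc k) ≡ ι (suc (2 ℕ.* k)) * b k
b-suc k = linear (b k * ι (suc (2 ℕ.* k))) (ι-inv (2 ℕ.* suc k))
  (lem (ι (2 ℕ.* suc k)) (inv (2 ℕ.* suc k)) (ι (suc (2 ℕ.* k))) (b k))
  where
  lem : ∀ d i o b → d * (b * (o * i)) - o * b ≡ b * o * (d * i - 1ℚ)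
  lem = solve-∀ ℚ-ring

central-step : ∀ k → ι (suc k) * binom (2 ℕ.* suc k) (suc k) ≡ (1ℚ + 1ℚ) * (ι (suc (2 ℕ.* k)) * binom (2 ℕ.* k) k)
central-step k = begin
  ι (suc k) * binom (2 ℕ.* suc k) (suc k)             ≡⟨ cong (λ m → ι (suc k) * binom m (suc k)) (2*-suc k) ⟩
  ι (suc k) * binom (suc (suc (2 ℕ.* k))) (suc k)     ≡⟨ binom-absorb (suc (2 ℕ.* k)) k ⟩
  ι (suc (suc (2 ℕ.* k))) * binom (suc (2 ℕ.* k)) k   ≡⟨ cong (_* B) (trans (cong ι (sym (2*-suc k))) (trans (ι-2* (suc k)) (cong₂ _+_ (ι-suc k) (ι-suc k)))) ⟩
  (1ℚ + ι k + (1ℚ + ι k)) * B                         ≡⟨ linear₃ (- (1ℚ + 1ℚ)) (1ℚ + 1ℚ) ((1ℚ + 1ℚ) * B) (binom-step (suc (2 ℕ.* k)) k) (binom-absorb (2 ℕ.* k) k) (sym (ι-odd k))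
                                                          (lem (ι k) (ι (suc k)) (ι (suc (2 ℕ.* k))) B (binom (suc (2 ℕ.* k)) (suc k)) (binom (2 ℕ.* k) k)) ⟩
  (1ℚ + 1ℚ) * (ι (suc (2 ℕ.* k)) * binom (2 ℕ.* k) k) ∎
  where
  open ≡-Reasoning
  B = binom (suc (2 ℕ.* k)) k
  lem : ∀ x x′ o B B′ c → (1ℚ + x + (1ℚ + x)) * B - (1ℚ + 1ℚ) * (o * c) ≡
        - (1ℚ + 1ℚ) * (x′ * B′ - (o - x) * B) + (1ℚ + 1ℚ) * (x′ * B′ - o * c) + (1ℚ + 1ℚ) * B * (1ℚ + (x + x) - o)
  lem = solve-∀ ℚ-ring

-- The recursion for `b` divides by even numbers that p may divide; this form shows that only a
-- power of 2 remains in the denominator, which is what `Div-b` needs.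
4^*b : ∀ k → ι (4 ^ k) * b k ≡ binom (2 ℕ.* k) k
4^*b zero    = trans (cong (_* 1ℚ) ι-1) (sym (binom-0 0))
4^*b (suc k) = *-cancelˡ-ι (2 ℕ.* suc k) (begin
  ι (2 ℕ.* suc k) * (ι (4 ℕ.* 4 ^ k) * b (suc k))    ≡⟨ cong (λ f → ι (2 ℕ.* suc k) * (f * b (suc k))) (ι-* 4 (4 ^ k)) ⟩
  ι (2 ℕ.* suc k) * (ι 4 * ι (4 ^ k) * b (suc k))    ≡⟨ linear₂ (ι 4 * ι (4 ^ k)) (ι 4 * ι (suc (2 ℕ.* k))) (b-suc k) (4^*b k)
                                                        (lem₁ (ι (2 ℕ.* suc k)) (ι 4) (ι (4 ^ k)) (b (suc k)) (ι (suc (2 ℕ.* k))) (b k) (binom (2 ℕ.* k) k)) ⟩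
  ι 4 * (ι (suc (2 ℕ.* k)) * binom (2 ℕ.* k) k)      ≡⟨ cong (_* (ι (suc (2 ℕ.* k)) * binom (2 ℕ.* k) k)) (trans (ι-2* 2) (cong₂ _+_ ι-2 ι-2)) ⟩
  (1ℚ + 1ℚ + (1ℚ + 1ℚ)) * (ι (suc (2 ℕ.* k)) * binom (2 ℕ.* k) k) ≡⟨ linear (- (1ℚ + 1ℚ)) (central-step k) (lem₂ (ι (suc k)) (binom (2 ℕ.* suc k) (suc k)) (ι (suc (2 ℕ.* k)) * binom (2 ℕ.* k) k)) ⟩
  (ι (suc k) + ι (suc k)) * binom (2 ℕ.* suc k) (suc k) ≡⟨ cong (_* binom (2 ℕ.* suc k) (suc k)) (ι-2* (suc k)) ⟨
  ι (2 ℕ.* suc k) * binom (2 ℕ.* suc k) (suc k)      ∎)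
  where
  open ≡-Reasoning
  ι-2 : ι 2 ≡ 1ℚ + 1ℚ
  ι-2 = trans (ι-2* 1) (cong₂ _+_ ι-1 ι-1)
  lem₁ : ∀ d f F b′ o b c → d * (f * F * b′) - f * (o * c) ≡ f * F * (d * b′ - o * b) + f * o * (F * b - c)
  lem₁ = solve-∀ ℚ-ring
  lem₂ : ∀ x B c → (1ℚ + 1ℚ + (1ℚ + 1ℚ)) * c - (x + x) * B ≡ - (1ℚ + 1ℚ) * (x * B - (1ℚ + 1ℚ) * c)
  lem₂ = solve-∀ ℚ-ring

term-b : ∀ k → term k ≡ b k * b k
term-b k = trans (natFrac-ι (c ^ 2) (16 ^ k)) (*-cancelˡ-ι (16 ^ k) {{ℕₚ.m^n≢0 16 k}} (begin
  ι (16 ^ k) * (ι (c ^ 2) * inv (16 ^ k))   ≡⟨ linear (ι (c ^ 2)) (ι-inv (16 ^ k) {{ℕₚ.m^n≢0 16 k}}) (lem₁ (ι (16 ^ k)) (ι (c ^ 2)) (inv (16 ^ k))) ⟩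
  ι (c ^ 2)                                 ≡⟨ trans (ι-* c (c ℕ.* 1)) (cong (λ m → ι c * ι m) (ℕₚ.*-identityʳ c)) ⟩
  ι c * ι c                                 ≡⟨ cong₂ _*_ (4^*b k) (4^*b k) ⟨
  ι (4 ^ k) * b k * (ι (4 ^ k) * b k)       ≡⟨ lem₂ (ι (4 ^ k)) (b k) ⟩
  ι (4 ^ k) * ι (4 ^ k) * (b k * b k)       ≡⟨ cong (_* (b k * b k)) (ι-* (4 ^ k) (4 ^ k)) ⟨
  ι (4 ^ k ℕ.* 4 ^ k) * (b k * b k)         ≡⟨ cong (λ m → ι m * (b k * b k)) (16^ k) ⟨
  ι (16 ^ k) * (b k * b k)                  ∎))
  where
  open ≡-Reasoning
  c = (2 ℕ.* k) C k
  lem₁ : ∀ d x i → d * (x * i) - x ≡ x * (d * i - 1ℚ)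
  lem₁ = solve-∀ ℚ-ring
  lem₂ : ∀ f b → f * b * (f * b) ≡ f * f * (b * b)
  lem₂ = solve-∀ ℚ-ring
  16^ : ∀ k → 16 ^ k ≡ 4 ^ k ℕ.* 4 ^ k
  16^ zero    = refl
  16^ (suc k) = trans (cong (16 ℕ.*_) (16^ k)) (lem (4 ^ k))
    where
    lem : ∀ x → 16 ℕ.* (x ℕ.* x) ≡ 4 ℕ.* x ℕ.* (4 ℕ.* x)
    lem = ℕ-Solver.solve-∀

-- The polynomials T k, the products Q N and their shifts

-- T k y = (- y)ₖ (1 + y)ₖ / (k !)², so that T k (ι n) = (-1)ᵏ binom n k · binom (n + k) k.
T : ℕ → ℚ → ℚ
T zero    y = 1ℚ
T (suc k) y = T k y * ((ι k - y) * (ι (suc k) + y) * (inv (suc k) * inv (suc k)))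

-- Q N y = ∏ (1 - y² / j²) over 1 ≤ j ≤ N
Q : ℕ → ℚ → ℚ
Q zero    y = 1ℚ
Q (suc N) y = Q N y * ((ι (suc N) - y) * (ι (suc N) + y) * (inv (suc N) * inv (suc N)))

-- A unit shift of y moves the two rising factorials in opposite directions. Hence T (k+1) at y - 1
-- and at y share the product Q k y and differ only in boundary factors.
T-Q⁻ : ∀ k y → T (suc k) (y - 1ℚ) ≡ Q k y * (y * (ι (suc k) - y) * (inv (suc k) * inv (suc k)))
T-Q⁻ zero y = trans (cong₂ (λ s t → 1ℚ * ((s - (y - 1ℚ)) * (t + (y - 1ℚ)) * (inv 1 * inv 1))) ι-0 ι-1)
  (trans (lem y (inv 1)) (cong (λ t → 1ℚ * (y * (t - y) * (inv 1 * inv 1))) (sym ι-1)))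
  where
  lem : ∀ y i → 1ℚ * ((0ℚ - (y - 1ℚ)) * (1ℚ + (y - 1ℚ)) * (i * i)) ≡ 1ℚ * (y * (1ℚ - y) * (i * i))
  lem = solve-∀ ℚ-ring
T-Q⁻ (suc k) y rewrite T-Q⁻ k y | ι-suc (suc k) = lem (Q k y) y (ι (suc k)) (inv (suc k)) (inv (suc (suc k)))
  where
  lem : ∀ q y x i i′ → q * (y * (x - y) * (i * i)) * ((x - (y - 1ℚ)) * (1ℚ + x + (y - 1ℚ)) * (i′ * i′)) ≡
        q * ((x - y) * (x + y) * (i * i)) * (y * (1ℚ + x - y) * (i′ * i′))
  lem = solve-∀ ℚ-ring

T-Q⁺ : ∀ k y → T (suc k) y ≡ Q k y * (- y * (ι (suc k) + y) * (inv (suc k) * inv (suc k)))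
T-Q⁺ zero y = trans (cong (λ s → 1ℚ * ((s - y) * (ι 1 + y) * (inv 1 * inv 1))) ι-0) (lem y (inv 1) (ι 1))
  where
  lem : ∀ y i x → 1ℚ * ((0ℚ - y) * (x + y) * (i * i)) ≡ 1ℚ * (- y * (x + y) * (i * i))
  lem = solve-∀ ℚ-ring
T-Q⁺ (suc k) y rewrite T-Q⁺ k y | ι-suc (suc k) = lem (Q k y) y (ι (suc k)) (inv (suc k)) (inv (suc (suc k)))
  where
  lem : ∀ q y x i i′ → q * (- y * (x + y) * (i * i)) * ((x - y) * (1ℚ + x + y) * (i′ * i′)) ≡
        q * ((x - y) * (x + y) * (i * i)) * (- y * (1ℚ + x + y) * (i′ * i′))
  lem = solve-∀ ℚ-ring

-- With x = N + 1, the boundary factors y (x - y) and -y (x + y) add up to -2y², and -2y²/x² times Q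
-- N y is exactly the increment of 2 Q.
∑T-shift : ∀ N y → ∑ (suc N) (λ k → T k (y - 1ℚ)) + ∑ (suc N) (λ k → T k y) ≡ (1ℚ + 1ℚ) * Q N y
∑T-shift zero    y = refl
∑T-shift (suc N) y = linear₂ 1ℚ c (∑T-shift N y) (ι-inv (suc N)) (begin
  (s + t + T (suc N) (y - 1ℚ)) + (s′ + t′ + T (suc N) y) - (1ℚ + 1ℚ) * Q (suc N) y
    ≡⟨ cong₂ (λ u v → (s + t + u) + (s′ + t′ + v) - (1ℚ + 1ℚ) * Q (suc N) y) (T-Q⁻ N y) (T-Q⁺ N y) ⟩
  _ ≡⟨ lem s t s′ t′ (Q N y) y (ι (suc N)) (inv (suc N)) ⟩
  _ ∎)
  where
  open ≡-Reasoning
  s = ∑ N (λ k → T k (y - 1ℚ))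
  t = T N (y - 1ℚ)
  s′ = ∑ N (λ k → T k y)
  t′ = T N y
  c = - (1ℚ + 1ℚ) * Q N y * (ι (suc N) * inv (suc N) + 1ℚ)
  lem : ∀ s t s′ t′ q y x i →
    (s + t + q * (y * (x - y) * (i * i))) + (s′ + t′ + q * (- y * (x + y) * (i * i))) - (1ℚ + 1ℚ) * (q * ((x - y) * (x + y) * (i * i)))
    ≡ 1ℚ * (s + t + (s′ + t′) - (1ℚ + 1ℚ) * q) + - (1ℚ + 1ℚ) * q * (x * i + 1ℚ) * (x * i - 1ℚ)
  lem = solve-∀ ℚ-ring

-- In each of the products of j - y and of j + y, one factor leaves at one end and one enters at the
-- other. Denominators are cleared, so zero factors do no harm.
Q-shift : ∀ N y → Q N (1ℚ + y) * ((y - ι N) * (1ℚ + y)) ≡ Q N y * (y * (1ℚ + y + ι N))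
Q-shift zero y = trans (cong (λ z → 1ℚ * ((y - z) * (1ℚ + y))) ι-0)
  (trans (lem y) (cong (λ z → 1ℚ * (y * (1ℚ + y + z))) (sym ι-0)))
  where
  lem : ∀ y → 1ℚ * ((y - 0ℚ) * (1ℚ + y)) ≡ 1ℚ * (y * (1ℚ + y + 0ℚ))
  lem = solve-∀ ℚ-ring
Q-shift (suc N) y rewrite ι-suc N =
  linear (- ((1ℚ + ι N + (1ℚ + y)) * (inv (suc N) * inv (suc N)) * (y - (1ℚ + ι N)))) (Q-shift N y)
    (lem (Q N (1ℚ + y)) (Q N y) y (ι N) (inv (suc N)))
  where
  lem : ∀ q′ q y x i →
    q′ * ((1ℚ + x - (1ℚ + y)) * (1ℚ + x + (1ℚ + y)) * (i * i)) * ((y - (1ℚ + x)) * (1ℚ + y))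
    - q * ((1ℚ + x - y) * (1ℚ + x + y) * (i * i)) * (y * (1ℚ + y + (1ℚ + x)))
    ≡ - ((1ℚ + x + (1ℚ + y)) * (i * i) * (y - (1ℚ + x))) * (q′ * ((y - x) * (1ℚ + y)) - q * (y * (1ℚ + y + x)))
  lem = solve-∀ ℚ-ring

Q-vanish : ∀ {N M} → M < N → Q N (ι (suc M)) ≡ 0ℚ
Q-vanish {suc N} {M} (s≤s M≤N) with ℕₚ.m≤n⇒m<n∨m≡n M≤N
... | inj₁ M<N = trans (cong (_* f) (Q-vanish M<N)) (ℚₚ.*-zeroˡ f)
  where f = (ι (suc N) - ι (suc M)) * (ι (suc N) + ι (suc M)) * (inv (suc N) * inv (suc N))
... | inj₂ refl = lem (Q N (ι (suc N))) (ι (suc N)) (inv (suc N))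
  where
  lem : ∀ q x i → q * ((x - x) * (x + x) * (i * i)) ≡ 0ℚ
  lem = solve-∀ ℚ-ring

∑T : ℕ → ℕ → ℚ
∑T N m = ∑ (suc N) (λ k → T k (ι m))

∑T-suc : ∀ N m → ∑T N (suc m) ≡ (1ℚ + 1ℚ) * Q N (ι (suc m)) - ∑T N m
∑T-suc N m = linear 1ℚ
  (trans (cong (λ y → ∑ (suc N) (λ k → T k y) + ∑T N (suc m)) ιm) (∑T-shift N (ι (suc m))))
  (lem (∑T N m) (∑T N (suc m)) ((1ℚ + 1ℚ) * Q N (ι (suc m))))
  where
  lem₀ : ∀ x → x ≡ 1ℚ + x - 1ℚ
  lem₀ = solve-∀ ℚ-ring
  ιm : ι m ≡ ι (suc m) - 1ℚ
  ιm = trans (lem₀ (ι m)) (cong (_- 1ℚ) (sym (ι-suc m)))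
  lem : ∀ s t q → t - (q - s) ≡ 1ℚ * (s + t - q)
  lem = solve-∀ ℚ-ring

∑T-0 : ∀ N → ∑T N 0 ≡ 1ℚ
∑T-0 zero    = refl
∑T-0 (suc N) = trans (cong₂ _+_ (∑T-0 N) (T-0 N)) refl
  where
  T-0 : ∀ k → T (suc k) (ι 0) ≡ 0ℚ
  T-0 k = trans (T-Q⁺ k (ι 0)) (trans (cong (λ z → Q k (ι 0) * (- z * (ι (suc k) + z) * (inv (suc k) * inv (suc k)))) ι-0)
    (lem′ (Q k (ι 0)) (ι (suc k)) (inv (suc k))))
    where
    lem′ : ∀ q x i → q * (- 0ℚ * (x + 0ℚ) * (i * i)) ≡ 0ℚ
    lem′ = solve-∀ ℚ-ring

-- For 1 ≤ m ≤ N the product Q N m contains a zero, so every unit shift merely flips the sign. The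
-- value is that of the Legendre polynomial of degree m at -1.
∑T-low : ∀ {N m} → m ≤ N → ∑T N m ≡ sign m
∑T-low {N} {zero}  _   = ∑T-0 N
∑T-low {N} {suc m} m<N = begin
  ∑T N (suc m)                                ≡⟨ ∑T-suc N m ⟩
  (1ℚ + 1ℚ) * Q N (ι (suc m)) - ∑T N m        ≡⟨ cong₂ (λ q s → (1ℚ + 1ℚ) * q - s) (Q-vanish m<N) (∑T-low (ℕₚ.<⇒≤ m<N)) ⟩
  (1ℚ + 1ℚ) * 0ℚ - sign m                     ≡⟨ lem (sign m) ⟩
  - sign m                                    ∎
  where
  open ≡-Reasoning
  lem : ∀ s → (1ℚ + 1ℚ) * 0ℚ - s ≡ - s
  lem = solve-∀ ℚ-ring

-- Beyond m = N the products Q no longer vanish, and each further shift leaves one of them behind as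
-- a correction. Needed at m = P + n with N = P - 1.
∑T-high : ∀ N t → ∑T N (N ℕ.+ t) ≡ sign t * (sign N - (1ℚ + 1ℚ) * ∑ t (λ i → sign i * Q N (ι (suc N ℕ.+ i))))
∑T-high N zero = trans (cong (∑T N) (ℕₚ.+-identityʳ N)) (trans (∑T-low {N} ℕₚ.≤-refl) (lem (sign N)))
  where
  lem : ∀ s → s ≡ 1ℚ * (s - (1ℚ + 1ℚ) * 0ℚ)
  lem = solve-∀ ℚ-ring
∑T-high N (suc t) = begin
  ∑T N (N ℕ.+ suc t)                          ≡⟨ cong (∑T N) (ℕₚ.+-suc N t) ⟩
  ∑T N (suc (N ℕ.+ t))                        ≡⟨ ∑T-suc N (N ℕ.+ t) ⟩
  (1ℚ + 1ℚ) * q - ∑T N (N ℕ.+ t)              ≡⟨ linear₂ (- 1ℚ) (- ((1ℚ + 1ℚ) * q)) (∑T-high N t) (sign² t) (lem (sign t) (sign N) q σ (∑T N (N ℕ.+ t))) ⟩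
  sign (suc t) * (sign N - (1ℚ + 1ℚ) * (σ + sign t * q)) ∎
  where
  open ≡-Reasoning
  q = Q N (ι (suc N ℕ.+ t))
  σ = ∑ t (λ i → sign i * Q N (ι (suc N ℕ.+ i)))
  lem : ∀ s S q σ f → (1ℚ + 1ℚ) * q - f - - s * (S - (1ℚ + 1ℚ) * (σ + s * q)) ≡
        - 1ℚ * (f - s * (S - (1ℚ + 1ℚ) * σ)) + - ((1ℚ + 1ℚ) * q) * (s * s - 1ℚ)
  lem = solve-∀ ℚ-ring

-- T k y as a function of (2y + 1)²

D : ℕ → ℚ → ℚ
D zero    c = 1ℚ
D (suc k) c = D k c * (1ℚ - c * (inv (suc (2 ℕ.* k)) * inv (suc (2 ℕ.* k))))

-- Factor by factor, 4 (j - 1 - y)(j + y) = (2j - 1)² - (2y + 1)², while b j / b (j - 1) = (2j -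
-- 1)/(2j).
T-b : ∀ k y → T k y ≡ b k * b k * D k ((1ℚ + (y + y)) * (1ℚ + (y + y)))
T-b zero    y = refl
T-b (suc k) y rewrite T-b k y = begin
  b k * b k * d * ((ι k - y) * (ι (suc k) + y) * (inv (suc k) * inv (suc k)))
    ≡⟨ cong₂ (λ x i → b k * b k * d * ((ι k - y) * (x + y) * (i * i))) (ι-suc k) (inv-half k) ⟩
  b k * b k * d * ((ι k - y) * (1ℚ + ι k + y) * ((j + j) * (j + j)))
    ≡⟨ linear (c′ * (1ℚ + o * i)) oi (lem (b k) d (ι k) y j o i) ⟩
  b k * (o * j) * (b k * (o * j)) * (d * (1ℚ - c * (i * i)))
    ≡⟨ cong (λ o → b k * (o * j) * (b k * (o * j)) * (d * (1ℚ - c * (i * i)))) (ι-odd k) ⟨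
  b (suc k) * b (suc k) * (d * (1ℚ - c * (i * i))) ∎
  where
  open ≡-Reasoning
  c = (1ℚ + (y + y)) * (1ℚ + (y + y))
  d = D k c
  i = inv (suc (2 ℕ.* k))
  j = inv (2 ℕ.* suc k)
  o = 1ℚ + (ι k + ι k)
  c′ = b k * b k * d * c * j * j
  oi : o * i ≡ 1ℚ
  oi = trans (cong (_* i) (sym (ι-odd k))) (ι-inv (suc (2 ℕ.* k)))
  lem : ∀ b d x y j o i → b * b * d * ((x - y) * (1ℚ + x + y) * ((j + j) * (j + j)))
     - b * ((1ℚ + (x + x)) * j) * (b * ((1ℚ + (x + x)) * j)) * (d * (1ℚ - ((1ℚ + (y + y)) * (1ℚ + (y + y))) * (i * i)))
     ≡ b * b * d * ((1ℚ + (y + y)) * (1ℚ + (y + y))) * j * j * (1ℚ + (1ℚ + (x + x)) * i) * ((1ℚ + (x + x)) * i - 1ℚ)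
  lem = solve-∀ ℚ-ring

T-binom : ∀ n k → T k (ι n) ≡ sign k * binom n k * binom (n ℕ.+ k) k
T-binom n zero    = sym (trans (cong₂ (λ x y → 1ℚ * x * y) (binom-0 n) (binom-0 (n ℕ.+ 0))) refl)
T-binom n (suc k) rewrite T-binom n k = begin
  s * B * B′ * ((ι k - ι n) * (ι (suc k) + ι n) * (i * i))
    ≡⟨ cong (λ z → s * B * B′ * ((ι k - ι n) * z * (i * i))) (trans (sym (ι-+ (suc k) n)) (cong ι (ℕₚ.+-comm (suc k) n))) ⟩
  s * B * B′ * ((ι k - ι n) * ι (n ℕ.+ suc k) * (i * i))
    ≡⟨ cong (λ m → s * B * B′ * ((ι k - ι n) * ι m * (i * i))) (ℕₚ.+-suc n k) ⟩
  s * B * B′ * ((ι k - ι n) * ι (suc (n ℕ.+ k)) * (i * i))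
    ≡⟨ linear₃ (s * B′ * ι (suc (n ℕ.+ k)) * i * i) (s * x * X * i * i)
         (- (s * X * X′ * (x * i + 1ℚ))) (binom-step n k) (binom-absorb (n ℕ.+ k) k) (ι-inv (suc k))
         (lem s B B′ (ι k) (ι n) (ι (suc (n ℕ.+ k))) i x X X′) ⟩
  - s * X * X′
    ≡⟨ cong (λ m → - s * X * binom m (suc k)) (ℕₚ.+-suc n k) ⟨
  - s * X * binom (n ℕ.+ suc k) (suc k) ∎
  where
  open ≡-Reasoning
  s = sign k
  B = binom n k
  B′ = binom (n ℕ.+ k) k
  X = binom n (suc k)
  X′ = binom (suc (n ℕ.+ k)) (suc k)
  x = ι (suc k)
  i = inv (suc k)
  lem : ∀ s B B′ k n m i x X X′ → s * B * B′ * ((k - n) * m * (i * i)) - - s * X * X′ ≡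
        s * B′ * m * i * i * (x * X - (n - k) * B) + s * x * X * i * i * (x * X′ - m * B′) + - (s * X * X′ * (x * i + 1ℚ)) * (x * i - 1ℚ)
  lem = solve-∀ ℚ-ring

-- The exact identity for S N

A : ℕ → ℚ
A N = ∑ (suc N) (λ l → binom (suc (2 ℕ.* N)) l * inv (suc (2 ℕ.* (N ∸ l))))

∑-telescope : ∀ n (f : ℕ → ℚ) → ∑ n (λ l → f (suc l) - f l) ≡ f n - f 0
∑-telescope zero    f = sym (ℚₚ.+-inverseʳ (f 0))
∑-telescope (suc n) f = trans (cong (_+ (f (suc n) - f n)) (∑-telescope n f)) (lem (f n) (f 0) (f (suc n)))
  where
  lem : ∀ x y z → x - y + (z - x) ≡ z - y
  lem = solve-∀ ℚ-ring

8ℚ : ℚ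
8ℚ = (1ℚ + 1ℚ) * ((1ℚ + 1ℚ) * (1ℚ + 1ℚ))

-- Raising l together with N keeps the denominator 2N + 1 - 2l, so the recurrence for `A` already
-- holds term by term, up to a telescoping difference.
A-term : ∀ N l → l ≤ N →
  ι (suc (2 ℕ.* suc N)) * (binom (suc (2 ℕ.* suc N)) (suc l) * inv (suc (2 ℕ.* (N ∸ l))))
  ≡ 8ℚ * ι (suc N) * (binom (suc (2 ℕ.* N)) l * inv (suc (2 ℕ.* (N ∸ l))))
    + (binom (2 ℕ.* suc N) (suc l) - binom (2 ℕ.* suc N) l)
A-term N l l≤N = begin
  ι (suc (2 ℕ.* suc N)) * (binom (suc (2 ℕ.* suc N)) (suc l) * i)
    ≡⟨ cong₂ (λ s t → s * (t * i)) ι₁ (binom-Pascal (2 ℕ.* suc N) l) ⟩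
  (1ℚ + (1ℚ + (1ℚ + (n + n)))) * ((Z + Y) * i)
    ≡⟨ linear₃ (- ((1ℚ + 1ℚ) * i)) ((1ℚ + 1ℚ) * (1ℚ + 1ℚ) * i) (Y - Z) step absorb oi (lem n (ι l) X Y Z i) ⟩
  8ℚ * (1ℚ + n) * (X * i) + (Y - Z)
    ≡⟨ cong (λ s → 8ℚ * s * (X * i) + (Y - Z)) (ι-suc N) ⟨
  8ℚ * ι (suc N) * (X * i) + (Y - Z) ∎
  where
  open ≡-Reasoning
  n = ι N
  i = inv (suc (2 ℕ.* (N ∸ l)))
  X = binom (suc (2 ℕ.* N)) l
  Y = binom (2 ℕ.* suc N) (suc l)
  Z = binom (2 ℕ.* suc N) l
  ι₀ : ι (2 ℕ.* suc N) ≡ 1ℚ + (1ℚ + (n + n))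
  ι₀ = trans (cong ι (2*-suc N)) (trans (ι-suc (suc (2 ℕ.* N))) (cong (λ z → 1ℚ + z) (ι-odd N)))
  ι₁ : ι (suc (2 ℕ.* suc N)) ≡ 1ℚ + (1ℚ + (1ℚ + (n + n)))
  ι₁ = trans (ι-suc (2 ℕ.* suc N)) (cong (λ z → 1ℚ + z) ι₀)
  step : (1ℚ + ι l) * Y ≡ (1ℚ + (1ℚ + (n + n)) - ι l) * Z
  step = trans (cong (_* Y) (sym (ι-suc l))) (trans (binom-step (2 ℕ.* suc N) l) (cong (λ z → (z - ι l) * Z) ι₀))
  absorb : (1ℚ + ι l) * Y ≡ (1ℚ + (1ℚ + (n + n))) * X
  absorb = trans (cong₂ (λ x m → x * binom m (suc l)) (sym (ι-suc l)) (2*-suc N))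
    (trans (binom-absorb (suc (2 ℕ.* N)) l) (cong (_* X) (trans (cong ι (sym (2*-suc N))) ι₀)))
  ι∸ : ι (N ∸ l) ≡ n - ι l
  ι∸ = trans (lem₀ (ι (N ∸ l)) (ι l)) (cong (_- ι l) (trans (sym (ι-+ (N ∸ l) l)) (cong ι (ℕₚ.m∸n+n≡m l≤N))))
    where
    lem₀ : ∀ x y → x ≡ x + y - y
    lem₀ = solve-∀ ℚ-ring
  oi : (1ℚ + ((n - ι l) + (n - ι l))) * i ≡ 1ℚ
  oi = trans (cong (λ z → (1ℚ + (z + z)) * i) (sym ι∸)) (trans (cong (_* i) (sym (ι-odd (N ∸ l)))) (ι-inv (suc (2 ℕ.* (N ∸ l)))))
  lem : ∀ n l X Y Z i →
    (1ℚ + (1ℚ + (1ℚ + (n + n)))) * ((Z + Y) * i) - ((1ℚ + 1ℚ) * ((1ℚ + 1ℚ) * (1ℚ + 1ℚ)) * (1ℚ + n) * (X * i) + (Y - Z))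
    ≡ - ((1ℚ + 1ℚ) * i) * ((1ℚ + l) * Y - (1ℚ + (1ℚ + (n + n)) - l) * Z)
      + (1ℚ + 1ℚ) * (1ℚ + 1ℚ) * i * ((1ℚ + l) * Y - (1ℚ + (1ℚ + (n + n))) * X)
      + (Y - Z) * ((1ℚ + ((n - l) + (n - l))) * i - 1ℚ)
  lem = solve-∀ ℚ-ring

A-suc : ∀ N → ι (suc (2 ℕ.* suc N)) * A (suc N) ≡ 8ℚ * ι (suc N) * A N + binom (2 ℕ.* suc N) (suc N)
A-suc N = begin
  o * A (suc N)
    ≡⟨ cong (o *_) (∑-head (suc N) (λ l → binom (suc (2 ℕ.* suc N)) l * inv (suc (2 ℕ.* (suc N ∸ l))))) ⟩
  o * (binom (suc (2 ℕ.* suc N)) 0 * inv (suc (2 ℕ.* suc N)) + ∑ (suc N) f)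
    ≡⟨ linear₂ (binom (suc (2 ℕ.* suc N)) 0) 1ℚ (ι-inv (suc (2 ℕ.* suc N))) (binom-0 (suc (2 ℕ.* suc N))) (lem₁ o (binom (suc (2 ℕ.* suc N)) 0) (inv (suc (2 ℕ.* suc N))) (∑ (suc N) f)) ⟩
  1ℚ + o * ∑ (suc N) f
    ≡⟨ cong (λ z → 1ℚ + z) (∑-* (suc N) o f) ⟨
  1ℚ + ∑ (suc N) (λ l → o * f l)
    ≡⟨ cong (λ z → 1ℚ + z) (∑-cong (suc N) (λ l l≤N → A-term N l (ℕₚ.≤-pred l≤N))) ⟩
  1ℚ + ∑ (suc N) (λ l → 8ℚ * ι (suc N) * g l + (h (suc l) - h l))
    ≡⟨ cong (λ z → 1ℚ + z) (∑-+ (suc N) (λ l → 8ℚ * ι (suc N) * g l) (λ l → h (suc l) - h l)) ⟩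
  1ℚ + (∑ (suc N) (λ l → 8ℚ * ι (suc N) * g l) + ∑ (suc N) (λ l → h (suc l) - h l))
    -- The leading 1 is the term l = 0 of A (N + 1), which has no partner in A N; it cancels against
    -- the lower end of the telescoping sum.
    ≡⟨ cong₂ (λ z w → 1ℚ + (z + w)) (∑-* (suc N) (8ℚ * ι (suc N)) g) (trans (∑-telescope (suc N) h) (cong (λ z → h (suc N) - z) (binom-0 (2 ℕ.* suc N)))) ⟩
  1ℚ + (8ℚ * ι (suc N) * A N + (h (suc N) - 1ℚ))
    ≡⟨ lem₂ (8ℚ * ι (suc N) * A N) (h (suc N)) ⟩
  8ℚ * ι (suc N) * A N + h (suc N) ∎
  where
  open ≡-Reasoning
  o = ι (suc (2 ℕ.* suc N))
  f = λ l → binom (suc (2 ℕ.* suc N)) (suc l) * inv (suc (2 ℕ.* (N ∸ l)))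
  g = λ l → binom (suc (2 ℕ.* N)) l * inv (suc (2 ℕ.* (N ∸ l)))
  h = binom (2 ℕ.* suc N)
  lem₁ : ∀ o B i s → o * (B * i + s) - (1ℚ + o * s) ≡ B * (o * i - 1ℚ) + 1ℚ * (B - 1ℚ)
  lem₁ = solve-∀ ℚ-ring
  lem₂ : ∀ x y → 1ℚ + (x + (y - 1ℚ)) ≡ x + y
  lem₂ = solve-∀ ℚ-ring

S : ℕ → ℚ
S N = ∑ (suc N) (λ k → b k * b k)

-- Both sides obey the same recurrence: since 4ᴺ⁺¹ b (N+1) = binom(2N+2,N+1), the inhomogeneous term
-- of `A-suc` times b (N+1) is the new summand of S.
S-A : ∀ N → ι (4 ^ N) * S N ≡ ι (suc (2 ℕ.* N)) * b N * A N
S-A zero = trans (cong₂ _*_ ι-1 (refl {x = S 0}))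
  (sym (trans (cong₂ (λ x y → x * 1ℚ * (0ℚ + y)) ι-1 (trans (cong₂ _*_ (binom-0 1) inv-1) refl)) refl))
S-A (suc N) = begin
  ι (4 ℕ.* 4 ^ N) * (S N + b′ * b′)
    ≡⟨ cong (_* (S N + b′ * b′)) (trans (ι-* 4 (4 ^ N)) (cong (_* ι (4 ^ N)) ι-4)) ⟩
  f * ι (4 ^ N) * (S N + b′ * b′)
    ≡⟨ lem₁ f (ι (4 ^ N)) (S N) b′ ⟩
  f * (ι (4 ^ N) * S N) + f * ι (4 ^ N) * b′ * b′
    ≡⟨ cong₂ (λ s t → f * s + t * b′) (S-A N) 4^b′ ⟩
  f * (ι (suc (2 ℕ.* N)) * b N * A N) + B * b′
    ≡⟨ cong (λ s → f * (s * A N) + B * b′) (trans (sym (b-suc N)) (cong (_* b′) (ι-2* (suc N)))) ⟩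
  f * ((ι (suc N) + ι (suc N)) * b′ * A N) + B * b′
    ≡⟨ linear (- b′) (A-suc N) (lem₂ (ι (suc N)) b′ (A N) B (ι (suc (2 ℕ.* suc N))) (A (suc N))) ⟩
  ι (suc (2 ℕ.* suc N)) * b′ * A (suc N) ∎
  where
  open ≡-Reasoning
  b′ = b (suc N)
  f = (1ℚ + 1ℚ) * (1ℚ + 1ℚ)
  B = binom (2 ℕ.* suc N) (suc N)
  ι-4 : ι 4 ≡ f
  ι-4 = trans (ι-* 2 2) (cong₂ _*_ ι-2 ι-2)
    where
    ι-2 : ι 2 ≡ 1ℚ + 1ℚ
    ι-2 = trans (ι-2* 1) (cong₂ _+_ ι-1 ι-1)
  4^b′ : f * ι (4 ^ N) * b′ ≡ B
  4^b′ = trans (cong (_* b′) (sym (trans (ι-* 4 (4 ^ N)) (cong (_* ι (4 ^ N)) ι-4)))) (4^*b (suc N))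
  lem₁ : ∀ f F s b → f * F * (s + b * b) ≡ f * (F * s) + f * F * b * b
  lem₁ = solve-∀ ℚ-ring
  lem₂ : ∀ x b a B o a′ → (1ℚ + 1ℚ) * (1ℚ + 1ℚ) * ((x + x) * b * a) + B * b - o * b * a′ ≡
    - b * (o * a′ - ((1ℚ + 1ℚ) * ((1ℚ + 1ℚ) * (1ℚ + 1ℚ)) * x * a + B))
  lem₂ = solve-∀ ℚ-ring

-- Two evaluations of T n at y = n: as b² D, and as (-1)ⁿ binom(2n,n). One factor binom(2n,n) = 4ⁿ b
-- n cancels.
b*D : ∀ n → b n * D n (ι (suc (2 ℕ.* n)) * ι (suc (2 ℕ.* n))) ≡ sign n * ι (4 ^ n)
b*D n = *-cancelˡ-ι c {{nCk≢0 (ℕₚ.m≤m+n n (n ℕ.+ 0))}} (begin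
  ι c * (b n * d)                          ≡⟨ cong (_* (b n * d)) (4^*b n) ⟨
  ι (4 ^ n) * b n * (b n * d)              ≡⟨ lem₁ (ι (4 ^ n)) (b n) d ⟩
  ι (4 ^ n) * (b n * b n * d)              ≡⟨ cong (ι (4 ^ n) *_) T-n ⟩
  ι (4 ^ n) * (sign n * ι c)               ≡⟨ lem₂ (ι (4 ^ n)) (sign n) (ι c) ⟩
  ι c * (sign n * ι (4 ^ n))               ∎)
  where
  open ≡-Reasoning
  c = (2 ℕ.* n) C n
  d = D n (ι (suc (2 ℕ.* n)) * ι (suc (2 ℕ.* n)))
  T-n : b n * b n * d ≡ sign n * ι c
  T-n = begin
    b n * b n * d                           ≡⟨ cong (λ z → b n * b n * D n (z * z)) (ι-odd n) ⟩
    b n * b n * D n ((1ℚ + (ι n + ι n)) * (1ℚ + (ι n + ι n))) ≡⟨ T-b n (ι n) ⟨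
    T n (ι n)                               ≡⟨ T-binom n n ⟩
    sign n * binom n n * binom (n ℕ.+ n) n  ≡⟨ cong₂ (λ x m → sign n * x * binom m n) (trans (cong ι (nCn≡1 n)) ι-1) (cong (n ℕ.+_) (sym (ℕₚ.+-identityʳ n))) ⟩
    sign n * 1ℚ * ι c                       ≡⟨ cong (_* ι c) (ℚₚ.*-identityʳ (sign n)) ⟩
    sign n * ι c                            ∎
  lem₁ : ∀ f b d → f * b * (b * d) ≡ f * (b * b * d)
  lem₁ = solve-∀ ℚ-ring
  lem₂ : ∀ f s c → f * (s * c) ≡ c * (s * f)
  lem₂ = solve-∀ ℚ-ring

-- `b*D` trades the factor b n of `S-A` for D, and the powers of 4 cancel. With P = 2n + 1, both D
-- and P · A n can be expanded modulo p³.
S*D : ∀ n → S n * D n (ι (suc (2 ℕ.* n)) * ι (suc (2 ℕ.* n))) ≡ sign n * (ι (suc (2 ℕ.* n)) * A n)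
S*D n = *-cancelˡ-ι (4 ^ n) {{ℕₚ.m^n≢0 4 n}}
  (linear₂ d (o * A n) (S-A n) (b*D n) (lem (ι (4 ^ n)) (S n) d o (A n) (b n) (sign n)))
  where
  o = ι (suc (2 ℕ.* n))
  d = D n (o * o)
  lem : ∀ f S d o a b s → f * (S * d) - f * (s * (o * a)) ≡ d * (f * S - o * b * a) + o * a * (b * d - s * f)
  lem = solve-∀ ℚ-ring

-- Leibniz's harmonic triangle

-- Relative to 1 / ((N+1) binom(N,i)), the reciprocals of binom(N+1,i) and binom(N+1,i+1) are N + 1
-- - i and i + 1, with sum N + 2.
inv-leibniz : ∀ N i → i ≤ N → inv (suc N) * inv (N C i) ≡
              inv (suc (suc N)) * inv (suc N C i) + inv (suc (suc N)) * inv (suc N C suc i)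
inv-leibniz N i i≤N = begin
  u * c                                                  ≡⟨ linear (- (u * c)) (trans (cong (_* w) (trans (sym (ι-suc (suc N))) refl)) (ι-inv (suc (suc N)))) (lem (ι (suc N)) (ι i) u c w) ⟩
  w * ((ι (suc N) - ι i) * u * c) + w * ((1ℚ + ι i) * u * c) ≡⟨ cong₂ (λ x y → w * x + w * y) lower upper ⟩
  w * inv (suc N C i) + w * inv (suc N C suc i)          ∎
  where
  open ≡-Reasoning
  u = inv (suc N)
  w = inv (suc (suc N))
  c = inv (N C i)
  instance
    _ = nCk≢0 {N} {i} i≤N
    _ = nCk≢0 {suc N} {i} (ℕₚ.m≤n⇒m≤1+n i≤N)
    _ = nCk≢0 {suc N} {suc i} (s≤s i≤N)
  lem : ∀ n i u c w → u * c - (w * ((n - i) * u * c) + w * ((1ℚ + i) * u * c)) ≡ - (u * c) * ((1ℚ + n) * w - 1ℚ)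
  lem = solve-∀ ℚ-ring
  absorb : (1ℚ + ι i) * binom (suc N) (suc i) ≡ ι (suc N) * binom N i
  absorb = trans (cong (_* binom (suc N) (suc i)) (sym (ι-suc i))) (binom-absorb N i)
  upper : (1ℚ + ι i) * u * c ≡ inv (suc N C suc i)
  upper = inv-unique (suc N C suc i) (linear₃ (u * c) (binom N i * c) 1ℚ absorb (ι-inv (suc N)) (ι-inv (N C i))
    (lem′ (binom (suc N) (suc i)) (ι i) u c (ι (suc N)) (binom N i)))
    where
    lem′ : ∀ B i u c n b → B * ((1ℚ + i) * u * c) - 1ℚ ≡ u * c * ((1ℚ + i) * B - n * b) + b * c * (n * u - 1ℚ) + 1ℚ * (b * c - 1ℚ)
    lem′ = solve-∀ ℚ-ring
  lower : (ι (suc N) - ι i) * u * c ≡ inv (suc N C i)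
  lower = inv-unique (suc N C i) (linear₃ (u * c) (binom N i * c) 1ℚ (trans (sym (binom-step (suc N) i)) (binom-absorb N i)) (ι-inv (suc N)) (ι-inv (N C i))
    (lem′ (binom (suc N) i) (ι i) u c (ι (suc N)) (binom N i)))
    where
    lem′ : ∀ B i u c n b → B * ((n - i) * u * c) - 1ℚ ≡ u * c * ((n - i) * B - n * b) + b * c * (n * u - 1ℚ) + 1ℚ * (b * c - 1ℚ)
    lem′ = solve-∀ ℚ-ring

-- The terms b k for k < P, up to factors ≡ 1 (mod p)

module PrimePower (p : ℕ) (p-prime : Prime p) (p∤2 : ¬ (p ∣ 2)) (a n′ : ℕ)
                  (p^a≡ : p ^ a ≡ suc (2 ℕ.* suc n′)) where

  open Localization p p-prime

  n P : ℕ
  n = suc n′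
  P = suc (2 ℕ.* n)

  -- Sums of reciprocals are written with P/i throughout: for a proper power P, 1/i need not be
  -- p-integral for i < P, while P/i is even divisible by p.
  s : ℕ → ℚ
  s i = ι P * inv i

  ι*s : ∀ i .{{_ : NonZero i}} → ι i * s i ≡ ι P
  ι*s i = linear (ι P) (ι-inv i) (lem (ι i) (ι P) (inv i))
    where
    lem : ∀ x P i → x * (P * i) - P ≡ P * (x * i - 1ℚ)
    lem = solve-∀ ℚ-ring

  s-small : ∀ {i} → ¬ (P ∣ i) → Div 1 (s i)
  s-small {i} ∤i = subst (λ q → Div 1 (ι q * inv i)) p^a≡ (Div-p^a/i a (λ p^a∣i → ∤i (subst (_∣ i) p^a≡ p^a∣i)))

  s-small-< : ∀ {i} → i < 2 ℕ.* n → Div 1 (s (suc i))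
  s-small-< i<2n = s-small (>⇒∤ (s≤s i<2n))

  s-double : ∀ i → s (suc i) ≡ s (2 ℕ.* suc i) + s (2 ℕ.* suc i)
  s-double i = trans (cong (ι P *_) (inv-half i)) (ℚₚ.*-distribˡ-+ (ι P) (inv (2 ℕ.* suc i)) (inv (2 ℕ.* suc i)))

  -- This is 1/i + 1/j = P/(ij) scaled by P. When p divides both, it gives P/j ≡ -P/i (mod p²).
  s-compl : ∀ {i j} .{{_ : NonZero i}} .{{_ : NonZero j}} → i ℕ.+ j ≡ P → s i + s j ≡ s i * s j
  s-compl {i} {j} i+j≡P = subst (λ x → x * inv i + x * inv j ≡ x * inv i * (x * inv j)) (trans (sym (ι-+ i j)) (cong ι i+j≡P))
    (linear₂ (- ((ι i + ι j) * inv j)) (- ((ι i + ι j) * inv i)) (ι-inv i) (ι-inv j) (lem (ι i) (ι j) (inv i) (inv j)))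
    where
    lem : ∀ i j I J → (i + j) * I + (i + j) * J - (i + j) * I * ((i + j) * J) ≡ - ((i + j) * J) * (i * I - 1ℚ) + - ((i + j) * I) * (j * J - 1ℚ)
    lem = solve-∀ ℚ-ring

  Div-ιP : Div 1 (ι P)
  Div-ιP = subst (Div 1) (trans (cong (ι P *_) inv-1) (ℚₚ.*-identityʳ (ι P))) (s-small-< {0} (s≤s z≤n))

  1-≡1 : ∀ {x} → Div 1 x → Cong 1 (1ℚ - x) 1ℚ
  1-≡1 {x} d = by-diff (lem x) (Div-neg d)
    where
    lem : ∀ x → - x ≡ 1ℚ - x - 1ℚ
    lem = solve-∀ ℚ-ring

  1+≡1 : ∀ {x} → Div 1 x → Cong 1 (1ℚ + x) 1ℚ
  1+≡1 {x} d = by-diff (lem x) d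
    where
    lem : ∀ x → x ≡ 1ℚ + x - 1ℚ
    lem = solve-∀ ℚ-ring

  ιP : ι P ≡ 1ℚ + (ι n + ι n)
  ιP = ι-odd n

  -- The ratio of consecutive values is (2i + 1)/(2i + 2) on the left and (2i + 1 - P)/(2i + 2) on
  -- the right; the quotient is 1 - P/(2i + 1).
  b-lower : ∀ i → i ≤ n → b i ~ sign i * binom n i
  b-lower zero    _   = ~-reflexive (sym (trans (cong (1ℚ *_) (binom-0 n)) refl))
  b-lower (suc i) i<n = ~-cancelˡ-ι (2 ℕ.* suc i) (~-trans (~-reflexive (b-suc i))
    (~-trans (~-* (~-reflexive (refl {x = ι o})) (b-lower i (ℕₚ.<⇒≤ i<n)))
      (mk~ (1-≡1 (s-small-< (ℕₚ.*-monoʳ-< 2 i<n))) (Cong-refl {x = 1ℚ}) eq)))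
    where
    o = suc (2 ℕ.* i)
    lem : ∀ o σ B s i′ B′ P n i → o * (σ * B) * (1ℚ - s) - ((i′ + i′) * (- σ * B′)) * 1ℚ ≡
      - (σ * B) * (o * s - P) + (σ + σ) * (i′ * B′ - (n - i) * B) + σ * B * ((o - P) - ((1ℚ + (i + i)) - (1ℚ + (n + n))))
    lem = solve-∀ ℚ-ring
    eq : ι o * (sign i * binom n i) * (1ℚ - s o) ≡ ι (2 ℕ.* suc i) * (sign (suc i) * binom n (suc i)) * 1ℚ
    eq = trans (linear₃ (- (sign i * binom n i)) (sign i + sign i) (sign i * binom n i) (ι*s o) (binom-step n i) (cong₂ _-_ (ι-odd i) ιP)
          (lem (ι o) (sign i) (binom n i) (s o) (ι (suc i)) (binom n (suc i)) (ι P) (ι n) (ι i)))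
        (cong (λ z → z * (sign (suc i) * binom n (suc i)) * 1ℚ) (sym (ι-2* (suc i))))

  b-n : b n ~ sign n
  b-n = ~-trans (b-lower n ℕₚ.≤-refl)
    (~-reflexive (trans (cong (sign n *_) (trans (cong ι (nCn≡1 n)) ι-1)) (ℚₚ.*-identityʳ (sign n))))

  -- Here the numerator 2n + 1 = P enters, over the denominator P + 1 ≡ 1.
  b-1+n : b (suc n) ~ sign n * ι P
  b-1+n = ~-trans (mk~ (1+≡1 Div-ιP) (Cong-refl {x = 1ℚ}) eq) (~-* b-n (~-reflexive (refl {x = ι P})))
    where
    lem : ∀ b P → b * (1ℚ + P) ≡ (1ℚ + P) * b
    lem = solve-∀ ℚ-ring
    lem′ : ∀ b P → P * b ≡ b * P * 1ℚ
    lem′ = solve-∀ ℚ-ring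
    eq : b (suc n) * (1ℚ + ι P) ≡ b n * ι P * 1ℚ
    eq = trans (lem (b (suc n)) (ι P)) (trans (cong (_* b (suc n)) (trans (sym (ι-suc P)) (cong ι (sym (2*-suc n)))))
      (trans (b-suc n) (lem′ (b n) (ι P))))

  -- With e = 2i + 2 and o = 2i + 3, one step multiplies b by (P + e)/(P + o) and the binomial
  -- coefficient by (P - o)/e. Together this is -(1 + P/e)(1 - P/o)/(1 + P/o).
  b-upper-binom : ∀ i → i ≤ n′ → b (suc n ℕ.+ i) * binom n′ i ~ sign i * (sign n * ι P)
  b-upper-binom zero _ = ~-trans (~-reflexive (trans (cong₂ (λ k B → b k * B) (ℕₚ.+-identityʳ (suc n)) (binom-0 n′)) (ℚₚ.*-identityʳ (b (suc n)))))
    (~-trans b-1+n (~-reflexive (sym (ℚₚ.*-identityˡ (sign n * ι P)))))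
  b-upper-binom (suc i) i<n′ = ~-trans step
    (~-trans (~-* (~-reflexive (refl {x = - 1ℚ})) (b-upper-binom i (ℕₚ.<⇒≤ i<n′))) (~-reflexive (lem₀ (sign i) (sign n * ι P))))
    where
    lem₀ : ∀ x y → - 1ℚ * (x * y) ≡ - x * y
    lem₀ = solve-∀ ℚ-ring
    k e o : ℕ
    k = suc n ℕ.+ i
    e = 2 ℕ.* suc i
    o = suc e
    x = ι (suc i)
    B = binom n′ i
    B′ = binom n′ (suc i)
    e<2n : e < 2 ℕ.* n
    e<2n = ℕₚ.*-monoʳ-< 2 (s≤s i<n′)
    se : Div 1 (s e)
    se = subst (λ m → Div 1 (s m)) (sym (2*-suc i)) (s-small-< (ℕₚ.<-trans (ℕₚ.n<1+n _) (subst (_< 2 ℕ.* n) (2*-suc i) e<2n)))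
    so : Div 1 (s o)
    so = s-small-< e<2n
    ι-2k+1 : ι (suc (2 ℕ.* k)) ≡ ι P + (x + x)
    ι-2k+1 = trans (cong ι (eqℕ n i)) (trans (ι-+ P e) (cong (λ z → ι P + z) (ι-2* (suc i))))
      where
      eqℕ : ∀ n i → suc (2 ℕ.* (suc n ℕ.+ i)) ≡ suc (2 ℕ.* n) ℕ.+ 2 ℕ.* suc i
      eqℕ = ℕ-Solver.solve-∀
    ι-2k+2 : ι (2 ℕ.* suc k) ≡ 1ℚ + (ι P + (x + x))
    ι-2k+2 = trans (cong ι (2*-suc k)) (trans (ι-suc (suc (2 ℕ.* k))) (cong (λ z → 1ℚ + z) ι-2k+1))
    rec : (1ℚ + (ι P + (x + x))) * b (suc k) ≡ (ι P + (x + x)) * b k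
    rec = trans (cong (_* b (suc k)) (sym ι-2k+2)) (trans (b-suc k) (cong (_* b k) ι-2k+1))
    oo : (1ℚ + (x + x)) * s o ≡ ι P
    oo = trans (cong (_* s o) (sym (ι-odd (suc i)))) (ι*s o)
    ee : (x + x) * s e ≡ ι P
    ee = trans (cong (_* s e) (sym (ι-2* (suc i)))) (ι*s e)
    dbl : x * B′ + x * B′ ≡ (ι P - 1ℚ - (x + x)) * B
    dbl = trans (cong₂ _+_ (binom-step n′ i) (binom-step n′ i)) (trans (lem (ι n′) (ι i) B)
        (cong₂ (λ y z → (y - 1ℚ - z) * B) (trans (cong₂ (λ u v → 1ℚ + (u + v)) (sym (ι-suc n′)) (sym (ι-suc n′))) (sym ιP)) (cong₂ _+_ (sym (ι-suc i)) (sym (ι-suc i)))))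
      where
      lem : ∀ n i B → (n - i) * B + (n - i) * B ≡ (1ℚ + (1ℚ + n + (1ℚ + n)) - 1ℚ - (1ℚ + i + (1ℚ + i))) * B
      lem = solve-∀ ℚ-ring
    -- Here x = i + 1. Scaling both sides by o = 1 + 2x and e = 2x lets P/o and P/e enter through
    -- their defining equations alone.
    alg : ∀ {x P b b′ B B′ so se} → (1ℚ + (P + (x + x))) * b′ ≡ (P + (x + x)) * b → x * B′ + x * B′ ≡ (P - 1ℚ - (x + x)) * B →
          (1ℚ + (x + x)) * so ≡ P → (x + x) * se ≡ P →
          (1ℚ + (x + x)) * ((x + x) * (b′ * B′ * (1ℚ + so))) ≡ (1ℚ + (x + x)) * ((x + x) * (- 1ℚ * (b * B) * ((1ℚ + se) * (1ℚ - so))))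
    alg {x} {P} {b} {b′} {B} {B′} {so} {se} h₁ h₂ h₃ h₄ =
      trans (linear₂ ((x + x) * B′) ((x + x) * (b′ * B′)) h₁ h₃ (lem₁ x P b b′ B B′ so))
      (trans (linear ((P + (x + x)) * b) h₂ (lem₂ x P b B B′))
        (linear₂ (b * B * ((1ℚ + (x + x)) * (1ℚ - so))) (b * B * (P + (x + x))) h₄ (sym h₃) (lem₃ x P b B so se)))
      where
      lem₁ : ∀ x P b b′ B B′ so → (1ℚ + (x + x)) * ((x + x) * (b′ * B′ * (1ℚ + so))) - (P + (x + x)) * b * ((x + x) * B′)
        ≡ (x + x) * B′ * ((1ℚ + (P + (x + x))) * b′ - (P + (x + x)) * b) + (x + x) * (b′ * B′) * ((1ℚ + (x + x)) * so - P)
      lem₁ = solve-∀ ℚ-ring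
      lem₂ : ∀ x P b B B′ → (P + (x + x)) * b * ((x + x) * B′) - (P + (x + x)) * b * ((P - 1ℚ - (x + x)) * B) ≡ (P + (x + x)) * b * (x * B′ + x * B′ - (P - 1ℚ - (x + x)) * B)
      lem₂ = solve-∀ ℚ-ring
      lem₃ : ∀ x P b B so se → (P + (x + x)) * b * ((P - 1ℚ - (x + x)) * B) - (1ℚ + (x + x)) * ((x + x) * (- 1ℚ * (b * B) * ((1ℚ + se) * (1ℚ - so))))
        ≡ b * B * ((1ℚ + (x + x)) * (1ℚ - so)) * ((x + x) * se - P) + b * B * (P + (x + x)) * (P - (1ℚ + (x + x)) * so)
      lem₃ = solve-∀ ℚ-ring
    step : b (suc n ℕ.+ suc i) * B′ ~ - 1ℚ * (b k * B)
    step = mk~ (1+≡1 so) (≡1-* (1+≡1 se) (1-≡1 so))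
      (trans (cong (λ m → b m * B′ * (1ℚ + s o)) (ℕₚ.+-suc (suc n) i))
        (*-cancelˡ-ι e (*-cancelˡ-ι o
          (subst₂ (λ y z → z * (y * (b (suc k) * B′ * (1ℚ + s o))) ≡ z * (y * (- 1ℚ * (b k * B) * ((1ℚ + s e) * (1ℚ - s o)))))
            (sym (ι-2* (suc i))) (sym (ι-odd (suc i))) (alg {x} {ι P} {b k} {b (suc k)} {B} {B′} {s o} {s e} rec dbl oo ee)))))
  -- On the edge i = 0 the entry is P/(N+1). Every further entry of the triangle is a difference of
  -- two entries with the previous i, so divisibility by p spreads inwards.
  P-leibniz : ∀ i N → i ≤ N → N < 2 ℕ.* n → Div 1 (ι P * (inv (suc N) * inv (N C i)))
  P-leibniz zero N _ N<2n = subst (Div 1) (lem (ι P) (inv (suc N)) (inv (N C 0)) inv-1) (s-small-< N<2n)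
    where
    lem : ∀ x y z → z ≡ 1ℚ → x * y ≡ x * (y * z)
    lem x y z refl = cong (x *_) (sym (ℚₚ.*-identityʳ y))
  P-leibniz (suc i) (suc N) (s≤s i≤N) N<2n = subst (Div 1) eq
    (Div-- (P-leibniz i N i≤N (ℕₚ.<-trans (ℕₚ.n<1+n N) N<2n)) (P-leibniz i (suc N) (ℕₚ.m≤n⇒m≤1+n i≤N) N<2n))
    where
    x = inv (suc (suc N)) * inv (suc N C i)
    y = inv (suc (suc N)) * inv (suc N C suc i)
    lem : ∀ P x y → P * (x + y) - P * x ≡ P * y
    lem = solve-∀ ℚ-ring
    eq : ι P * (inv (suc N) * inv (N C i)) - ι P * x ≡ ι P * y
    eq = trans (cong (λ z → ι P * z - ι P * x) (inv-leibniz N i i≤N)) (lem (ι P) x y)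

  P/C : ℕ → ℚ
  P/C i = ι P * inv (n′ C i)

  Div-P/C : ∀ i → i ≤ n′ → Div 1 (P/C i)
  Div-P/C i i≤n′ = subst (Div 1) (linear (P/C i) (ι-inv n) (lem (ι n) (ι P) (inv n) (inv (n′ C i))))
    (Div-scale (Div-ι n) (P-leibniz i n′ i≤n′ (ℕₚ.<-≤-trans (ℕₚ.n<1+n n′) (ℕₚ.m≤m+n n (n ℕ.+ 0)))))
    where
    lem : ∀ n P i c → n * (P * (i * c)) - P * c ≡ P * c * (n * i - 1ℚ)
    lem = solve-∀ ℚ-ring

  b-upper : ∀ i → i ≤ n′ → b (suc n ℕ.+ i) ~ sign i * sign n * P/C i
  b-upper i i≤n′ = ~-cancelˡ-ι (n′ C i) (~-trans (~-reflexive (ℚₚ.*-comm (binom n′ i) (b (suc n ℕ.+ i))))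
    (~-trans (b-upper-binom i i≤n′) (~-reflexive (linear (- (sign i * sign n * ι P)) (ι-inv (n′ C i))
      (lem (sign i) (sign n) (ι P) (binom n′ i) (inv (n′ C i)))))))
    where
    instance _ = nCk≢0 {n′} {i} i≤n′
    lem : ∀ s t P c i → s * (t * P) - c * (s * t * (P * i)) ≡ - (s * t * P) * (c * i - 1ℚ)
    lem = solve-∀ ℚ-ring

  b²-upper : ∀ i → i ≤ n′ → b (suc n ℕ.+ i) * b (suc n ℕ.+ i) ~ P/C i * P/C i
  b²-upper i i≤n′ = ~-trans (~-* (b-upper i i≤n′) (b-upper i i≤n′)) (~-reflexive
    (linear₂ (sign n * sign n * P/C i * P/C i) (P/C i * P/C i) (sign² i) (sign² n) (lem (sign i) (sign n) (P/C i))))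
    where
    lem : ∀ s t x → s * t * x * (s * t * x) - x * x ≡ t * t * x * x * (s * s - 1ℚ) + x * x * (t * t - 1ℚ)
    lem = solve-∀ ℚ-ring

  Div-b-upper : ∀ i → i ≤ n′ → Div 1 (b (suc n ℕ.+ i))
  Div-b-upper i i≤n′ = Div-resp-~ (b-upper i i≤n′) (Div-scale (Div-* {0} {0} (Div-sign i) (Div-sign n)) (Div-P/C i i≤n′))

  Div-b²-upper : ∀ i → i ≤ n′ → Div 2 (b (suc n ℕ.+ i) * b (suc n ℕ.+ i))
  Div-b²-upper i i≤n′ = Div-* {1} {1} (Div-b-upper i i≤n′) (Div-b-upper i i≤n′)

  b²-upper-Cong : ∀ i → i ≤ n′ → Cong 3 (b (suc n ℕ.+ i) * b (suc n ℕ.+ i)) (P/C i * P/C i)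
  b²-upper-Cong i i≤n′ = ~⇒Cong (Div-b²-upper i i≤n′) (Div-* {1} {1} (Div-P/C i i≤n′) (Div-P/C i i≤n′)) (b²-upper i i≤n′)

  -- This is the symmetry of row n - 1 of Pascal's triangle; the two indices add up to 3n + 1 = (3P
  -- - 1)/2.
  b²-symmetric : ∀ i → i ≤ n′ → Cong 3 (b (suc n ℕ.+ (n′ ∸ i)) * b (suc n ℕ.+ (n′ ∸ i))) (b (suc n ℕ.+ i) * b (suc n ℕ.+ i))
  b²-symmetric i i≤n′ = Cong-trans (b²-upper-Cong (n′ ∸ i) (ℕₚ.m∸n≤m n′ i))
    (Cong-trans (Cong-reflexive (cong (λ c → ι P * inv c * (ι P * inv c)) (sym (nCk≡nC[n∸k] i≤n′)))) (Cong-sym (b²-upper-Cong i i≤n′)))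

  -- Sums of P²/j² modulo p³

  sq : ℕ → ℚ
  sq i = s i * s i

  -- The ranges are odd j, even j, even j with sign (-1)^(j/2), and all j, for 0 < j < P.
  O R R± H : ℚ
  O  = ∑ n (λ i → sq (suc (2 ℕ.* i)))
  R  = ∑ n (λ i → sq (2 ℕ.* suc i))
  R± = ∑ n (λ i → sign (suc i) * sq (2 ℕ.* suc i))
  H  = ∑ (2 ℕ.* n) (λ j → sq (suc j))

  s-odd : ∀ {i} → i < n → Div 1 (s (suc (2 ℕ.* i)))
  s-odd i<n = s-small-< (ℕₚ.*-monoʳ-< 2 i<n)

  s-even : ∀ {i} → i < n → Div 1 (s (2 ℕ.* suc i))
  s-even {i} i<n = subst (λ m → Div 1 (s m)) (sym (2*-suc i))
    (s-small-< (ℕₚ.<-≤-trans (ℕₚ.n<1+n (suc (2 ℕ.* i))) (subst (_≤ 2 ℕ.* n) (2*-suc i) (ℕₚ.*-monoʳ-≤ 2 i<n))))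

  sq-small : ∀ {i} → Div 1 (s i) → Div 2 (sq i)
  sq-small d = Div-* {1} {1} d d

  Div-O : Div 2 O
  Div-O = Div-∑ n (λ i i<n → sq-small (s-odd i<n))

  Div-R± : Div 2 R±
  Div-R± = Div-∑ n (λ i i<n → Div-scale (Div-sign (suc i)) (sq-small (s-even i<n)))

  -- By `s-compl` the difference of squares is s i · s j · (s i - s j), three factors divisible by
  -- p.
  sq-compl : ∀ {i j} .{{_ : NonZero i}} .{{_ : NonZero j}} → i ℕ.+ j ≡ P → Div 1 (s i) → Div 1 (s j) → Cong 3 (sq i) (sq j)
  sq-compl {i} {j} i+j≡P di dj = by-diff (trans (cong (_* (s i - s j)) (sym (s-compl i+j≡P))) (lem (s i) (s j)))
    (Div-* {2} {1} (Div-* {1} {1} di dj) (Div-- di dj))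
    where
    lem : ∀ x y → (x + y) * (x - y) ≡ x * x - y * y
    lem = solve-∀ ℚ-ring

  ∑-even-odd : ∀ m f → ∑ (2 ℕ.* m) f ≡ ∑ m (λ i → f (2 ℕ.* i)) + ∑ m (λ i → f (suc (2 ℕ.* i)))
  ∑-even-odd zero    f = refl
  ∑-even-odd (suc m) f = trans (cong (λ k → ∑ k f) (2*-suc m)) (trans (cong (λ z → z + f (2 ℕ.* m) + f (suc (2 ℕ.* m))) (∑-even-odd m f))
    (lem (∑ m (λ i → f (2 ℕ.* i))) (∑ m (λ i → f (suc (2 ℕ.* i)))) (f (2 ℕ.* m)) (f (suc (2 ℕ.* m)))))
    where
    lem : ∀ x y z w → x + y + z + w ≡ x + z + (y + w)
    lem = solve-∀ ℚ-ring

  H≡O+R : H ≡ O + R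
  H≡O+R = trans (∑-even-odd n (λ j → sq (suc j))) (cong (λ z → O + z) (∑-cong n (λ i _ → cong sq (sym (2*-suc i)))))

  n∸ : ∀ {i} → i < n → suc i ℕ.+ (n ∸ suc i) ≡ n
  n∸ = ℕₚ.m+[n∸m]≡n

  -- The reflection of j to P - j exchanges parities because P is odd.
  O≡R : Cong 3 O R
  O≡R = Cong-trans (Cong-∑ n (λ i i<n → sq-compl {suc (2 ℕ.* i)} {2 ℕ.* suc (n ∸ suc i)} (eq i i<n) (s-odd i<n) (s-even (s≤s (ℕₚ.m∸n≤m n′ i)))))
    (Cong-reflexive (sym (∑-reverse n (λ i → sq (2 ℕ.* suc i)))))
    where
    eqℕ : ∀ i j → suc (2 ℕ.* i) ℕ.+ 2 ℕ.* suc j ≡ suc (2 ℕ.* (suc i ℕ.+ j))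
    eqℕ = ℕ-Solver.solve-∀
    eq : ∀ i → i < n → suc (2 ℕ.* i) ℕ.+ 2 ℕ.* suc (n ∸ suc i) ≡ P
    eq i i<n = trans (eqℕ i (n ∸ suc i)) (cong (λ m → suc (2 ℕ.* m)) (n∸ i<n))

  -- The lower half j ≤ n contributes exactly 4 R, since P/j = 2 P/(2j); the reflection folds the
  -- upper half onto it.
  H≡8R : Cong 3 H (8ℚ * R)
  H≡8R = Cong-trans (Cong-reflexive (trans (cong (λ m → ∑ (n ℕ.+ m) (λ j → sq (suc j))) (ℕₚ.+-identityʳ n)) (∑-split n n (λ j → sq (suc j)))))
    (Cong-trans (Cong-+ (Cong-refl {x = G}) upper) (Cong-reflexive (trans (cong₂ _+_ G≡4R G≡4R) (lem R))))
    where
    G = ∑ n (λ i → sq (suc i))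
    f = (1ℚ + 1ℚ) * (1ℚ + 1ℚ)
    lem : ∀ r → (1ℚ + 1ℚ) * (1ℚ + 1ℚ) * r + (1ℚ + 1ℚ) * (1ℚ + 1ℚ) * r ≡ (1ℚ + 1ℚ) * ((1ℚ + 1ℚ) * (1ℚ + 1ℚ)) * r
    lem = solve-∀ ℚ-ring
    lem′ : ∀ x → (x + x) * (x + x) ≡ (1ℚ + 1ℚ) * (1ℚ + 1ℚ) * (x * x)
    lem′ = solve-∀ ℚ-ring
    G≡4R : G ≡ f * R
    G≡4R = trans (∑-cong n (λ i _ → trans (cong (λ x → x * x) (s-double i)) (lem′ (s (2 ℕ.* suc i))))) (∑-* n f (λ i → sq (2 ℕ.* suc i)))
    eqℕ : ∀ n i j → suc (n ℕ.+ i) ℕ.+ suc j ≡ suc (n ℕ.+ (suc i ℕ.+ j))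
    eqℕ = ℕ-Solver.solve-∀
    eq : ∀ i → i < n → suc (n ℕ.+ i) ℕ.+ suc (n ∸ suc i) ≡ P
    eq i i<n = trans (eqℕ n i (n ∸ suc i)) (cong suc (trans (cong (n ℕ.+_) (n∸ i<n)) (cong (n ℕ.+_) (sym (ℕₚ.+-identityʳ n)))))
    upper : Cong 3 (∑ n (λ i → sq (suc (n ℕ.+ i)))) G
    upper = Cong-trans (Cong-∑ n (λ i i<n → sq-compl {suc (n ℕ.+ i)} {suc (n ∸ suc i)} (eq i i<n)
        (s-small-< (subst (n ℕ.+ i <_) (cong (n ℕ.+_) (sym (ℕₚ.+-identityʳ n))) (ℕₚ.+-monoʳ-< n i<n)))
        (s-small-< (ℕₚ.<-≤-trans (s≤s (ℕₚ.m∸n≤m n′ i)) (ℕₚ.m≤m+n n (n ℕ.+ 0))))))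
      (Cong-reflexive (sym (∑-reverse n (λ i → sq (suc i)))))

  Div-2 : Div 0 (1ℚ + 1ℚ)
  Div-2 = Div-+ Div-1 Div-1

  Div-8 : Div 0 8ℚ
  Div-8 = Div-* {0} {0} Div-2 (Div-* {0} {0} Div-2 Div-2)

  -- Comparing H = O + R ≡ 2 R with H ≡ 8 R gives 6 R ≡ 0, which also covers p = 3.
  8O+2H≡0 : Div 3 (8ℚ * O + (1ℚ + 1ℚ) * H)
  8O+2H≡0 = subst (Div 3) (trans (lem O R) (cong (λ h → 8ℚ * O + (1ℚ + 1ℚ) * h) (sym H≡O+R)))
    (Div-+ (Div-scale (Div-+ Div-8 Div-2) (diff O≡R)) (Div-scale Div-2 6R))
    where
    6R : Div 3 ((8ℚ - (1ℚ + 1ℚ)) * R)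
    6R = subst (Div 3) (lem₆ O R) (Div-+ (Div-neg (diff (Cong-trans (Cong-reflexive (sym H≡O+R)) H≡8R))) (diff O≡R))
      where
      lem₆ : ∀ O R → - (O + R - (1ℚ + 1ℚ) * ((1ℚ + 1ℚ) * (1ℚ + 1ℚ)) * R) + (O - R) ≡ ((1ℚ + 1ℚ) * ((1ℚ + 1ℚ) * (1ℚ + 1ℚ)) - (1ℚ + 1ℚ)) * R
      lem₆ = solve-∀ ℚ-ring
    lem : ∀ O R → ((1ℚ + 1ℚ) * ((1ℚ + 1ℚ) * (1ℚ + 1ℚ)) + (1ℚ + 1ℚ)) * (O - R) + (1ℚ + 1ℚ) * (((1ℚ + 1ℚ) * ((1ℚ + 1ℚ) * (1ℚ + 1ℚ)) - (1ℚ + 1ℚ)) * R)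
        ≡ ((1ℚ + 1ℚ) * ((1ℚ + 1ℚ) * (1ℚ + 1ℚ))) * O + (1ℚ + 1ℚ) * (O + R)
    lem = solve-∀ ℚ-ring

  -- The value of S n

  p∤2^ : ∀ k → ¬ (p ∣ 2 ^ k)
  p∤2^ k = p∤^ k p∤2

  Div-b : ∀ k → Div 0 (b k)
  Div-b k = subst (Div 0) (linear₂ (b k) (- inv (4 ^ k)) (ι-inv (4 ^ k) {{ℕₚ.m^n≢0 4 k}}) (4^*b k)
      (lem (inv (4 ^ k)) (binom (2 ℕ.* k) k) (b k) (ι (4 ^ k))))
    (Div-* {0} {0} (Div-inv (p∤^ k (p∤2^ 2))) (Div-ι ((2 ℕ.* k) C k)))
    where
    lem : ∀ i B b f → i * B - b ≡ b * (f * i - 1ℚ) + - i * (f * b - B)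
    lem = solve-∀ ℚ-ring

  Div-S : ∀ N → Div 0 (S N)
  Div-S N = Div-∑ (suc N) (λ k _ → Div-* {0} {0} (Div-b k) (Div-b k))

  binom-P : ∀ l → binom P (suc l) ≡ s (suc l) * binom (2 ℕ.* n) l
  binom-P l = *-cancelˡ-ι (suc l) (trans (binom-absorb (2 ℕ.* n) l)
    (trans (cong (_* binom (2 ℕ.* n) l) (sym (ι*s (suc l)))) (ℚₚ.*-assoc (ι (suc l)) (s (suc l)) (binom (2 ℕ.* n) l))))

  -- Neighbours in row P - 1 add up to binom(P,l+1), which is P/(l+1) times an integer and so
  -- vanishes modulo p.
  binom-2n : ∀ l → l ≤ 2 ℕ.* n → Cong 1 (binom (2 ℕ.* n) l) (sign l)
  binom-2n zero    _    = Cong-reflexive (binom-0 (2 ℕ.* n))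
  binom-2n (suc l) l<2n = by-diff eq (Div-- (Div-* {1} {0} (s-small-< l<2n) (Div-ι ((2 ℕ.* n) C l))) (diff (binom-2n l (ℕₚ.<⇒≤ l<2n))))
    where
    lem : ∀ x y z → x + y - (x - z) ≡ y - - z
    lem = solve-∀ ℚ-ring
    eq : s (suc l) * binom (2 ℕ.* n) l - (binom (2 ℕ.* n) l - sign l) ≡ binom (2 ℕ.* n) (suc l) - sign (suc l)
    eq = trans (cong (_- (binom (2 ℕ.* n) l - sign l)) (trans (sym (binom-P l)) (binom-Pascal (2 ℕ.* n) l)))
      (lem (binom (2 ℕ.* n) l) (binom (2 ℕ.* n) (suc l)) (sign l))

  -- Put r = P/(2l+2). Then binom(P,l+1) = 2 r binom(P-1,l), the remaining factor P/(P-2l-2) is ≡ -r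
  -- (mod p²) by `s-compl`, and binom(P-1,l) ≡ (-1)ˡ.
  A-tail-term : ∀ l → l < n → Cong 3 (ι P * (binom P (suc l) * inv (suc (2 ℕ.* (n ∸ suc l))))) ((1ℚ + 1ℚ) * (sign (suc l) * sq (2 ℕ.* suc l)))
  A-tail-term l l<n = by-diff eq
    (Div-- (Div-scale Div-2 (Div-* {1} {2} r∈ (Div-* {0} {2} (Div-ι ((2 ℕ.* n) C l)) (subst (Div 2) (sym so+r) (Div-* {1} {1} so∈ r∈)))))
           (Div-scale Div-2 (Div-* {1} {2} r∈ (Div-* {1} {1} (diff (binom-2n l l≤2n)) r∈))))
    where
    m = n ∸ suc l
    r = s (2 ℕ.* suc l)
    so = s (suc (2 ℕ.* m))
    B = binom (2 ℕ.* n) l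
    r∈ : Div 1 r
    r∈ = s-even l<n
    so∈ : Div 1 so
    so∈ = s-odd (s≤s (ℕₚ.m∸n≤m n′ l))
    l≤2n : l ≤ 2 ℕ.* n
    l≤2n = ℕₚ.≤-trans (ℕₚ.<⇒≤ l<n) (ℕₚ.m≤m+n n (n ℕ.+ 0))
    eqℕ : ∀ i j → suc (2 ℕ.* j) ℕ.+ 2 ℕ.* suc i ≡ suc (2 ℕ.* (suc i ℕ.+ j))
    eqℕ = ℕ-Solver.solve-∀
    so+r : so + r ≡ so * r
    so+r = s-compl {suc (2 ℕ.* m)} {2 ℕ.* suc l} (trans (eqℕ l m) (cong (λ k → suc (2 ℕ.* k)) (n∸ l<n)))
    lem : ∀ r B P i σ → (1ℚ + 1ℚ) * (r * (B * (P * i + r))) - (1ℚ + 1ℚ) * (r * ((B - σ) * r)) ≡ P * ((r + r) * B * i) - (1ℚ + 1ℚ) * (- σ * (r * r))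
    lem = solve-∀ ℚ-ring
    eq : (1ℚ + 1ℚ) * (r * (B * (so + r))) - (1ℚ + 1ℚ) * (r * ((B - sign l) * r)) ≡
         ι P * (binom P (suc l) * inv (suc (2 ℕ.* m))) - (1ℚ + 1ℚ) * (sign (suc l) * sq (2 ℕ.* suc l))
    eq = trans (lem r B (ι P) (inv (suc (2 ℕ.* m))) (sign l))
      (cong (λ z → ι P * (z * inv (suc (2 ℕ.* m))) - (1ℚ + 1ℚ) * (- sign l * (r * r)))
        (trans (cong (_* B) (sym (s-double l))) (sym (binom-P l))))

  P*A : Cong 3 (ι P * A n) (1ℚ + (1ℚ + 1ℚ) * R±)
  P*A = Cong-trans (Cong-reflexive eq) (Cong-+ (Cong-refl {x = 1ℚ})
    (Cong-trans (Cong-∑ n A-tail-term) (Cong-reflexive (∑-* n (1ℚ + 1ℚ) (λ i → sign (suc i) * sq (2 ℕ.* suc i))))))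
    where
    f = λ l → binom P (suc l) * inv (suc (2 ℕ.* (n ∸ suc l)))
    lem : ∀ P B i s → P * (B * i + s) - (1ℚ + P * s) ≡ B * (P * i - 1ℚ) + 1ℚ * (B - 1ℚ)
    lem = solve-∀ ℚ-ring
    eq : ι P * A n ≡ 1ℚ + ∑ n (λ l → ι P * f l)
    eq = trans (cong (ι P *_) (∑-head n (λ l → binom P l * inv (suc (2 ℕ.* (n ∸ l))))))
      (trans (linear₂ (binom P 0) 1ℚ (ι-inv P) (binom-0 P) (lem (ι P) (binom P 0) (inv P) (∑ n f)))
        (cong (λ z → 1ℚ + z) (sym (∑-* n (ι P) f))))

  O≤ : ℕ → ℚ
  O≤ k = ∑ k (λ i → sq (suc (2 ℕ.* i)))

  Div-O≤ : ∀ k → k ≤ n → Div 2 (O≤ k)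
  Div-O≤ k k≤n = Div-∑ k (λ i i<k → sq-small (s-odd (ℕₚ.<-≤-trans i<k k≤n)))

  -- As k ≤ n, all odd numbers 2j - 1 involved are below P, so each factor is 1 minus a multiple of
  -- p² and the cross terms carry p⁴.
  D-lower : ∀ c → Div 0 c → ∀ k → k ≤ n → Cong 3 (D k (c * (ι P * ι P))) (1ℚ - c * O≤ k)
  D-lower c c∈ zero    _   = Cong-reflexive (lem c)
    where
    lem : ∀ c → 1ℚ ≡ 1ℚ - c * 0ℚ
    lem = solve-∀ ℚ-ring
  D-lower c c∈ (suc k) k<n = by-diff (lem (D k (c * (ι P * ι P))) c (ι P) (inv (suc (2 ℕ.* k))) (O≤ k))
    (Div-+ (Div-* {3} {0} (diff (D-lower c c∈ k k≤n)) (Div-- Div-1 (Div-scale c∈ (Div-pred (Div-pred q∈)))))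
           (Div-* {2} {1} (Div-scale c∈ (Div-O≤ k k≤n)) (Div-pred (Div-scale c∈ q∈))))
    where
    k≤n = ℕₚ.<⇒≤ k<n
    q∈ : Div 2 (sq (suc (2 ℕ.* k)))
    q∈ = sq-small (s-odd k<n)
    lem : ∀ d c P i o → (d - (1ℚ - c * o)) * (1ℚ - c * (P * i * (P * i))) + c * o * (c * (P * i * (P * i))) ≡
      d * (1ℚ - c * (P * P) * (i * i)) - (1ℚ - c * (o + P * i * (P * i)))
    lem = solve-∀ ℚ-ring

  -- `S*D` reads S n (1 - O) ≡ (-1)ⁿ (1 + 2 R±). It first gives S n ≡ (-1)ⁿ modulo p, which is
  -- enough to replace S n in S n · O because p² divides O.
  S-n : Cong 3 (S n) (sign n * (1ℚ + (1ℚ + 1ℚ) * R± + O))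
  S-n = by-diff (linear 1ℚ (sym (S*D n)) (lem (S n) d (sign n) y R± O))
    (Div-+ (Div-- (Div-scale (Div-sign n) (diff P*A)) (Div-scale (Div-S n) d≡)) (Div-* {1} {2} S≡sign Div-O))
    where
    d = D n (ι P * ι P)
    y = ι P * A n
    lem₁ : ∀ d O → d - (1ℚ - 1ℚ * O) ≡ d - (1ℚ - O)
    lem₁ = solve-∀ ℚ-ring
    d≡ : Div 3 (d - (1ℚ - O))
    d≡ = subst (Div 3) (trans (cong (λ z → D n z - (1ℚ - 1ℚ * O)) (ℚₚ.*-identityˡ (ι P * ι P))) (lem₁ d O)) (diff (D-lower 1ℚ Div-1 n ℕₚ.≤-refl))
    lem₂ : ∀ S d σ y R O → σ * (y - (1ℚ + (1ℚ + 1ℚ) * R)) + σ * ((1ℚ + 1ℚ) * R) - (S * (d - (1ℚ - O)) - S * O) - (S - σ) ≡ - 1ℚ * (S * d - σ * y)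
    lem₂ = solve-∀ ℚ-ring
    S≡sign : Div 1 (S n - sign n)
    S≡sign = subst (Div 1) (linear (- 1ℚ) (S*D n) (lem₂ (S n) d (sign n) y R± O))
      (Div-- (Div-+ (Div-scale (Div-sign n) (Div-pred (Div-pred (diff P*A)))) (Div-scale (Div-sign n) (Div-scale Div-2 (Div-pred Div-R±))))
             (Div-- (Div-scale (Div-S n) (Div-pred (Div-pred d≡))) (Div-scale (Div-S n) (Div-pred Div-O))))
    lem : ∀ S d σ y R O → σ * (y - (1ℚ + (1ℚ + 1ℚ) * R)) - S * (d - (1ℚ - O)) + (S - σ) * O - (S - σ * (1ℚ + (1ℚ + 1ℚ) * R + O))
      ≡ 1ℚ * (σ * y - S * d)
    lem = solve-∀ ℚ-ring

  -- Extrapolation of S (P - 1)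

  9ℚ : ℚ
  9ℚ = (1ℚ + 1ℚ + 1ℚ) * (1ℚ + 1ℚ + 1ℚ)

  Div-9 : Div 0 9ℚ
  Div-9 = Div-* {0} {0} (Div-+ Div-2 Div-1) (Div-+ Div-2 Div-1)

  D₁ D₉ : ℕ → ℚ
  D₁ k = D k (1ℚ * (ι P * ι P))
  D₉ k = D k (9ℚ * (ι P * ι P))

  T-D₁ : ∀ k → T k (ι n) ≡ b k * b k * D₁ k
  T-D₁ k = trans (T-b k (ι n)) (cong (λ z → b k * b k * D k z) (trans (cong (λ x → x * x) (sym ιP)) (sym (ℚₚ.*-identityˡ (ι P * ι P)))))

  T-D₉ : ∀ k → T k (ι (P ℕ.+ n)) ≡ b k * b k * D₉ k
  T-D₉ k = trans (T-b k (ι (P ℕ.+ n))) (cong (λ z → b k * b k * D k z) (trans (cong (λ x → x * x) eq) (lem (ι P))))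
    where
    lem : ∀ x → (1ℚ + 1ℚ + 1ℚ) * x * ((1ℚ + 1ℚ + 1ℚ) * x) ≡ (1ℚ + 1ℚ + 1ℚ) * (1ℚ + 1ℚ + 1ℚ) * (x * x)
    lem = solve-∀ ℚ-ring
    lem′ : ∀ P n → 1ℚ + ((P + n) + (P + n)) - (1ℚ + 1ℚ + 1ℚ) * P ≡ - 1ℚ * (P - (1ℚ + (n + n)))
    lem′ = solve-∀ ℚ-ring
    eq : 1ℚ + (ι (P ℕ.+ n) + ι (P ℕ.+ n)) ≡ (1ℚ + 1ℚ + 1ℚ) * ι P
    eq = trans (cong (λ z → 1ℚ + (z + z)) (ι-+ P n)) (linear (- 1ℚ) ιP (lem′ (ι P) (ι n)))

  -- For k > n the product contains the factor with 2j - 1 = P, which is exactly 1 - 9. The other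
  -- odd numbers are below 3P and not multiples of P, so their factors are ≡ 1.
  D₉-upper : ∀ i → i < n → Cong 1 (D₉ (suc n ℕ.+ i)) (- 8ℚ)
  D₉-upper zero _ = subst (λ k → Cong 1 (D₉ k) (- 8ℚ)) (sym (ℕₚ.+-identityʳ (suc n))) (by-diff (sym (linear c (ι-inv P) (lem (D₉ n) (ι P) (inv P) O)))
    (Div-scale (Div-neg Div-8) (Div-- (Div-pred (Div-pred (diff (D-lower 9ℚ Div-9 n ℕₚ.≤-refl)))) (Div-scale Div-9 (Div-pred Div-O)))))
    where
    c = - (D₉ n * 9ℚ * (ι P * inv P + 1ℚ))
    lem : ∀ d P i o → d * (1ℚ - (1ℚ + 1ℚ + 1ℚ) * (1ℚ + 1ℚ + 1ℚ) * (P * P) * (i * i)) - - ((1ℚ + 1ℚ) * ((1ℚ + 1ℚ) * (1ℚ + 1ℚ)))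
        - (- ((1ℚ + 1ℚ) * ((1ℚ + 1ℚ) * (1ℚ + 1ℚ))) * (d - (1ℚ - (1ℚ + 1ℚ + 1ℚ) * (1ℚ + 1ℚ + 1ℚ) * o) - (1ℚ + 1ℚ + 1ℚ) * (1ℚ + 1ℚ + 1ℚ) * o))
      ≡ - (d * ((1ℚ + 1ℚ + 1ℚ) * (1ℚ + 1ℚ + 1ℚ)) * (P * i + 1ℚ)) * (P * i - 1ℚ)
    lem = solve-∀ ℚ-ring
  D₉-upper (suc i) i<n = subst (λ k → Cong 1 (D₉ k) (- 8ℚ)) (sym (ℕₚ.+-suc (suc n) i)) (by-diff (lem (D₉ k) (ι P) (inv o) 9ℚ 8ℚ)
    (Div-- (diff ih) (Div-* {0} {1} (Div-resp-Cong (Cong-pred ih) (Div-neg Div-8)) (Div-scale Div-9 (Div-pred (sq-small so))))))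
    where
    k = suc n ℕ.+ i
    o = suc (2 ℕ.* k)
    ih = D₉-upper i (ℕₚ.<-trans (ℕₚ.n<1+n i) i<n)
    eqℕ : ∀ n i → suc (2 ℕ.* (suc n ℕ.+ i)) ≡ suc (2 ℕ.* n) ℕ.+ 2 ℕ.* suc i
    eqℕ = ℕ-Solver.solve-∀
    so : Div 1 (s o)
    so = s-small (λ P∣o → >⇒∤ (s≤s (ℕₚ.*-monoʳ-≤ 2 (ℕₚ.<⇒≤ i<n))) (∣m+n∣m⇒∣n (subst (P ∣_) (eqℕ n i) P∣o) ∣-refl))
    lem : ∀ d P i c e → d - - e - d * (c * (P * i * (P * i))) ≡ d * (1ℚ - c * (P * P) * (i * i)) - - e
    lem = solve-∀ ℚ-ring

  -- For k ≤ n the linear terms cancel in 9 (1 - O) - (1 - 9 O), where O is the partial sum up to k.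
  -- For k > n the first term vanishes because binom(n,k) = 0, and -D₉ ≡ 8 modulo p meets the factor
  -- p² of b k².
  8b² : ∀ k → k < P → Cong 3 (8ℚ * (b k * b k)) (9ℚ * T k (ι n) - T k (ι (P ℕ.+ n)))
  8b² k k<P with k ℕₚ.≤? n
  ... | yes k≤n = Cong-sym (by-diff (trans (lem (b k * b k) (D₁ k) (D₉ k) (O≤ k))
          (cong₂ (λ x y → 9ℚ * x - y - 8ℚ * (b k * b k)) (sym (T-D₁ k)) (sym (T-D₉ k))))
        (Div-scale (Div-* {0} {0} (Div-b k) (Div-b k)) (Div-- (Div-scale Div-9 (diff (D-lower 1ℚ Div-1 k k≤n))) (diff (D-lower 9ℚ Div-9 k k≤n)))))
    where
    lem : ∀ a d₁ d₉ o → a * ((1ℚ + 1ℚ + 1ℚ) * (1ℚ + 1ℚ + 1ℚ) * (d₁ - (1ℚ - 1ℚ * o)) - (d₉ - (1ℚ - (1ℚ + 1ℚ + 1ℚ) * (1ℚ + 1ℚ + 1ℚ) * o))) ≡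
      (1ℚ + 1ℚ + 1ℚ) * (1ℚ + 1ℚ + 1ℚ) * (a * d₁) - a * d₉ - (1ℚ + 1ℚ) * ((1ℚ + 1ℚ) * (1ℚ + 1ℚ)) * a
    lem = solve-∀ ℚ-ring
  ... | no k≰n = Cong-sym (by-diff (trans (lem (b k * b k) (D₉ k)) (cong₂ (λ x y → 9ℚ * x - y - 8ℚ * (b k * b k)) (sym T₀) (sym (T-D₉ k))))
        (Div-neg (Div-* {2} {1} (subst (λ m → Div 2 (b m * b m)) k≡ (Div-b²-upper i (ℕₚ.≤-pred i<n)))
          (subst (λ m → Div 1 (D₉ m - - 8ℚ)) k≡ (diff (D₉-upper i i<n))))))
    where
    i = k ∸ suc n
    k≡ : suc n ℕ.+ i ≡ k
    k≡ = ℕₚ.m+[n∸m]≡n (ℕₚ.≰⇒> k≰n)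
    i<n : i < n
    i<n = ℕₚ.+-cancelˡ-< (suc n) i n (subst₂ _<_ (sym k≡) (cong (λ m → suc (n ℕ.+ m)) (ℕₚ.+-identityʳ n)) k<P)
    T₀ : T k (ι n) ≡ 0ℚ
    T₀ = trans (T-binom n k) (trans (cong (λ z → sign k * z * binom (n ℕ.+ k) k) (binom-> (ℕₚ.≰⇒> k≰n))) (lem₀ (sign k) (binom (n ℕ.+ k) k)))
      where
      lem₀ : ∀ x y → x * 0ℚ * y ≡ 0ℚ
      lem₀ = solve-∀ ℚ-ring
    lem : ∀ a d → - (a * (d - - ((1ℚ + 1ℚ) * ((1ℚ + 1ℚ) * (1ℚ + 1ℚ))))) ≡ (1ℚ + 1ℚ + 1ℚ) * (1ℚ + 1ℚ + 1ℚ) * 0ℚ - a * d - (1ℚ + 1ℚ) * ((1ℚ + 1ℚ) * (1ℚ + 1ℚ)) * a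
    lem = solve-∀ ℚ-ring

  Q-P : ∀ N → N ≤ 2 ℕ.* n → Cong 3 (Q N (ι P)) (1ℚ - ∑ N (λ j → sq (suc j)))
  Q-P zero    _    = Cong-reflexive refl
  Q-P (suc N) N<2n = by-diff (sym (linear c (ι-inv (suc N)) (lem (Q N (ι P)) (ι (suc N)) (ι P) (inv (suc N)) h)))
    (Div-+ (Div-* {3} {0} (diff (Q-P N N≤2n)) (Div-- Div-1 (Div-pred (Div-pred q∈))))
           (Div-* {2} {1} h∈ (Div-pred q∈)))
    where
    N≤2n = ℕₚ.<⇒≤ N<2n
    h = ∑ N (λ j → sq (suc j))
    h∈ : Div 2 h
    h∈ = Div-∑ N (λ j j<N → sq-small (s-small-< (ℕₚ.<-≤-trans j<N N≤2n)))
    q∈ : Div 2 (sq (suc N))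
    q∈ = sq-small (s-small-< N<2n)
    c = Q N (ι P) * (ι (suc N) * inv (suc N) + 1ℚ)
    lem : ∀ q x P i h → q * ((x - P) * (x + P) * (i * i)) - (1ℚ - (h + P * i * (P * i)))
          - ((q - (1ℚ - h)) * (1ℚ - P * i * (P * i)) + h * (P * i * (P * i)))
        ≡ q * (x * i + 1ℚ) * (x * i - 1ℚ)
    lem = solve-∀ ℚ-ring

  -- `Q-shift` at y = P + t with N = P - 1, where y - N = t + 1 and 1 + y + N = 2P + t.
  Q-step : ∀ t → Q (2 ℕ.* n) (ι (P ℕ.+ suc t)) * (ι (suc t) * (ι (suc t) + ι P)) ≡
                 Q (2 ℕ.* n) (ι (P ℕ.+ t)) * ((ι P + ι t) * (ι P + ι P + ι t))
  Q-step t = trans (cong₂ (λ y z → Q N y * z) e₁ (trans (cong (_* (ι (suc t) + ι P)) e₂) (cong (e₂′ *_) e₃)))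
    (trans (Q-shift N (ι (P ℕ.+ t))) (cong (Q N (ι (P ℕ.+ t)) *_) (cong₂ _*_ (ι-+ P t) e₄)))
    where
    N = 2 ℕ.* n
    e₂′ = ι (P ℕ.+ t) - ι N
    e₁ : ι (P ℕ.+ suc t) ≡ 1ℚ + ι (P ℕ.+ t)
    e₁ = trans (cong ι (ℕₚ.+-suc P t)) (ι-suc (P ℕ.+ t))
    l₂ : ∀ N t → 1ℚ + t ≡ 1ℚ + N + t - N
    l₂ = solve-∀ ℚ-ring
    e₂ : ι (suc t) ≡ e₂′
    e₂ = trans (ι-suc t) (trans (l₂ (ι N) (ι t)) (cong (_- ι N) (sym (trans (ι-+ P t) (cong (_+ ι t) (ι-suc N))))))
    l₃ : ∀ t P → 1ℚ + t + P ≡ 1ℚ + (P + t)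
    l₃ = solve-∀ ℚ-ring
    e₃ : ι (suc t) + ι P ≡ 1ℚ + ι (P ℕ.+ t)
    e₃ = trans (cong (_+ ι P) (ι-suc t)) (trans (l₃ (ι t) (ι P)) (cong (λ z → 1ℚ + z) (sym (ι-+ P t))))
    l₄ : ∀ P N t → 1ℚ + (P + t) + N ≡ P + (1ℚ + N) + t
    l₄ = solve-∀ ℚ-ring
    e₄ : 1ℚ + ι (P ℕ.+ t) + ι N ≡ ι P + ι P + ι t
    e₄ = trans (cong (λ z → 1ℚ + z + ι N) (ι-+ P t)) (trans (l₄ (ι P) (ι N) (ι t)) (cong (λ z → ι P + z + ι t) (sym (ι-suc N))))

  -- Only the first step beyond y = P brings in P, through its factors P and 2P. Every later step
  -- multiplies Q · (t+1)² by a quotient of factors 1 + P/i and 1 + 2P/i.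
  Q-upper-~ : ∀ t → t < n → Q (2 ℕ.* n) (ι (P ℕ.+ suc t)) * (ι (suc t) * ι (suc t)) ~ (1ℚ + 1ℚ) * (ι P * ι P)
  Q-upper-~ zero _ = mk~ (1+≡1 Div-ιP) Q≡1
    (trans (linear (Q′ * ι 1 * ι P) ι-1 (lem₁ Q′ (ι 1) (ι P)))
      (trans (Q-step 0) (trans (cong₂ (λ y z → Q (2 ℕ.* n) (ι y) * ((ι P + z) * (ι P + ι P + z))) (ℕₚ.+-identityʳ P) ι-0) (lem₂ (Q (2 ℕ.* n) (ι P)) (ι P)))))
    where
    Q′ = Q (2 ℕ.* n) (ι (P ℕ.+ 1))
    Q≡1 : Cong 1 (Q (2 ℕ.* n) (ι P)) 1ℚ
    Q≡1 = by-diff (lem (Q (2 ℕ.* n) (ι P)) H) (Div-- (Div-pred (Div-pred (diff (Q-P (2 ℕ.* n) ℕₚ.≤-refl))))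
      (Div-pred (Div-∑ (2 ℕ.* n) (λ j j<2n → sq-small (s-small-< j<2n)))))
      where
      lem : ∀ q h → q - (1ℚ - h) - h ≡ q - 1ℚ
      lem = solve-∀ ℚ-ring
    lem₁ : ∀ q o P → q * (o * o) * (1ℚ + P) - q * (o * (o + P)) ≡ q * o * P * (o - 1ℚ)
    lem₁ = solve-∀ ℚ-ring
    lem₂ : ∀ q P → q * ((P + 0ℚ) * (P + P + 0ℚ)) ≡ (1ℚ + 1ℚ) * (P * P) * q
    lem₂ = solve-∀ ℚ-ring
  Q-upper-~ (suc t) t<n = ~-trans
    (mk~ (1+≡1 (small t<n)) (≡1-* (1+≡1 s∈) (1+≡1 (Div-+ s∈ s∈))) eq) (Q-upper-~ t (ℕₚ.<-trans (ℕₚ.n<1+n t) t<n))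
    where
    small : ∀ {t} → t < n → Div 1 (s (suc t))
    small t<n = s-small-< (ℕₚ.<-≤-trans t<n (ℕₚ.m≤m+n n (n ℕ.+ 0)))
    s∈ : Div 1 (s (suc t))
    s∈ = small (ℕₚ.<-trans (ℕₚ.n<1+n t) t<n)
    x = ι (suc t)
    x′ = ι (suc (suc t))
    q = Q (2 ℕ.* n) (ι (P ℕ.+ suc t))
    q′ = Q (2 ℕ.* n) (ι (P ℕ.+ suc (suc t)))
    lem₁ : ∀ q x s P → q * (x * x) * (1ℚ + s) - q * (x * (x + P)) ≡ q * x * (x * s - P)
    lem₁ = solve-∀ ℚ-ring
    lem₂ : ∀ q x s P → q * ((P + x) * (P + P + x)) - q * (x * x) * ((1ℚ + s) * (1ℚ + (s + s)))
      ≡ - (q * (P + P + x) + q * (x + x) * (1ℚ + s)) * (x * s - P)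
    lem₂ = solve-∀ ℚ-ring
    eq : q′ * (x′ * x′) * (1ℚ + s (suc (suc t))) ≡ q * (x * x) * ((1ℚ + s (suc t)) * (1ℚ + (s (suc t) + s (suc t))))
    eq = trans (linear (q′ * x′) (ι*s (suc (suc t))) (lem₁ q′ x′ (s (suc (suc t))) (ι P))) (trans (Q-step (suc t))
      (linear (- (q * (ι P + ι P + x) + q * (x + x) * (1ℚ + s (suc t)))) (ι*s (suc t)) (lem₂ q x (s (suc t)) (ι P))))

  -- 2P²/(t+1)² is rewritten as 8 (P/(2t+2))², so that the alternating sum becomes the `R±` of
  -- `S-n`.
  Q-upper : ∀ t → t < n → Cong 3 (Q (2 ℕ.* n) (ι (P ℕ.+ suc t))) (8ℚ * sq (2 ℕ.* suc t))
  Q-upper t t<n = ~⇒Cong (Div-resp-~ rel r∈) r∈ rel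
    where
    x = ι (suc t)
    q = Q (2 ℕ.* n) (ι (P ℕ.+ suc t))
    r∈ : Div 2 (8ℚ * sq (2 ℕ.* suc t))
    r∈ = Div-scale Div-8 (sq-small (s-even t<n))
    lem₀ : ∀ q x → x * (x * q) ≡ q * (x * x)
    lem₀ = solve-∀ ℚ-ring
    lem : ∀ x r P → (1ℚ + 1ℚ) * (P * P) - x * (x * ((1ℚ + 1ℚ) * ((1ℚ + 1ℚ) * (1ℚ + 1ℚ)) * (r * r))) ≡ - ((1ℚ + 1ℚ) * (x * (r + r) + P)) * (x * (r + r) - P)
    lem = solve-∀ ℚ-ring
    rel : q ~ 8ℚ * sq (2 ℕ.* suc t)
    rel = ~-cancelˡ-ι (suc t) (~-cancelˡ-ι (suc t) (~-trans (~-reflexive (lem₀ q x)) (~-trans (Q-upper-~ t t<n)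
      (~-reflexive (linear (- ((1ℚ + 1ℚ) * (x * (s (2 ℕ.* suc t) + s (2 ℕ.* suc t)) + ι P))) (trans (cong (x *_) (sym (s-double t))) (ι*s (suc t)))
        (lem x (s (2 ℕ.* suc t)) (ι P)))))))

  ∑Q : Cong 3 (∑ (suc n) (λ i → sign i * Q (2 ℕ.* n) (ι (P ℕ.+ i)))) (1ℚ - H + 8ℚ * R±)
  ∑Q = Cong-trans (Cong-reflexive (trans (∑-head n (λ i → sign i * Q (2 ℕ.* n) (ι (P ℕ.+ i)))) (cong (_+ tail)
        (trans (ℚₚ.*-identityˡ (Q (2 ℕ.* n) (ι (P ℕ.+ 0)))) (cong (λ m → Q (2 ℕ.* n) (ι m)) (ℕₚ.+-identityʳ P))))))
    (Cong-+ (Q-P (2 ℕ.* n) ℕₚ.≤-refl) (Cong-trans (Cong-∑ n (λ i i<n → Cong-scale (Div-sign (suc i)) (Q-upper i i<n)))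
      (Cong-reflexive (trans (∑-cong n (λ i _ → lem (sign (suc i)) 8ℚ (sq (2 ℕ.* suc i)))) (∑-* n 8ℚ (λ i → sign (suc i) * sq (2 ℕ.* suc i)))))))
    where
    tail = ∑ n (λ i → sign (suc i) * Q (2 ℕ.* n) (ι (P ℕ.+ suc i)))
    lem : ∀ x y z → x * (y * z) ≡ y * (x * z)
    lem = solve-∀ ℚ-ring

  -- The sum runs over k ≤ 2n. Thus y = n falls under `∑T-low`, whereas y = P + n = 2n + (n + 1)
  -- needs `∑T-high` with n + 1 corrections: the one at y = P yields H, the others R±.
  8S-2n : Cong 3 (8ℚ * S (2 ℕ.* n)) (sign n * (8ℚ + (1ℚ + 1ℚ) * H - (1ℚ + 1ℚ) * (8ℚ * R±)))
  8S-2n = Cong-trans (Cong-reflexive (sym (∑-* P 8ℚ (λ k → b k * b k))))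
    (Cong-trans (Cong-∑ P 8b²) (Cong-trans (Cong-reflexive eq)
      (by-diff (lem (sign n) σ H R±) (Div-scale (Div-neg Div-2) (Div-scale (Div-sign n) (diff ∑Q))))))
    where
    σ = ∑ (suc n) (λ i → sign i * Q (2 ℕ.* n) (ι (P ℕ.+ i)))
    eqℕ : ∀ n → suc (2 ℕ.* n) ℕ.+ n ≡ 2 ℕ.* n ℕ.+ suc n
    eqℕ = ℕ-Solver.solve-∀
    lem₀ : ∀ x y → x - y ≡ x + - 1ℚ * y
    lem₀ = solve-∀ ℚ-ring
    eq : ∑ P (λ k → 9ℚ * T k (ι n) - T k (ι (P ℕ.+ n))) ≡ 9ℚ * sign n + - 1ℚ * (sign (suc n) * (1ℚ - (1ℚ + 1ℚ) * σ))
    eq = trans (∑-cong P (λ k _ → lem₀ (9ℚ * T k (ι n)) (T k (ι (P ℕ.+ n))))) (trans (∑-+ P (λ k → 9ℚ * T k (ι n)) (λ k → - 1ℚ * T k (ι (P ℕ.+ n))))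
      (cong₂ _+_ (trans (∑-* P 9ℚ (λ k → T k (ι n))) (cong (9ℚ *_) (∑T-low {2 ℕ.* n} {n} (ℕₚ.m≤m+n n (n ℕ.+ 0)))))
        (trans (∑-* P (- 1ℚ) (λ k → T k (ι (P ℕ.+ n)))) (cong (- 1ℚ *_) (trans (cong (∑T (2 ℕ.* n)) (eqℕ n))
          (trans (∑T-high (2 ℕ.* n) (suc n)) (cong (λ z → sign (suc n) * (z - (1ℚ + 1ℚ) * σ)) (sign-even n))))))))
    lem : ∀ s σ h r → - (1ℚ + 1ℚ) * (s * (σ - (1ℚ - h + (1ℚ + 1ℚ) * ((1ℚ + 1ℚ) * (1ℚ + 1ℚ)) * r))) ≡
      (1ℚ + 1ℚ + 1ℚ) * (1ℚ + 1ℚ + 1ℚ) * s + - 1ℚ * (- s * (1ℚ - (1ℚ + 1ℚ) * σ))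
      - s * ((1ℚ + 1ℚ) * ((1ℚ + 1ℚ) * (1ℚ + 1ℚ)) + (1ℚ + 1ℚ) * h - (1ℚ + 1ℚ) * ((1ℚ + 1ℚ) * ((1ℚ + 1ℚ) * (1ℚ + 1ℚ)) * r))
    lem = solve-∀ ℚ-ring

  Cong-cancel-2 : ∀ {e x y} → Cong e ((1ℚ + 1ℚ) * x) ((1ℚ + 1ℚ) * y) → Cong e x y
  Cong-cancel-2 {e} {x} {y} c = by-diff (lem x y) (Div-scale (Div-inv p∤2) (diff c))
    where
    lem₀ : ∀ h x y → h * ((1ℚ + 1ℚ) * x - (1ℚ + 1ℚ) * y) - (x - y) ≡ (x - y) * ((1ℚ + 1ℚ) * h - 1ℚ)
    lem₀ = solve-∀ ℚ-ring
    lem : ∀ x y → inv 2 * ((1ℚ + 1ℚ) * x - (1ℚ + 1ℚ) * y) ≡ x - y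
    lem x y = linear (x - y) (trans (cong (_* inv 2) (sym (trans (ι-2* 1) (cong₂ _+_ ι-1 ι-1)))) (ι-inv 2)) (lem₀ (inv 2) x y)

  -- Eight times `S-n` contributes 16 R± and `8S-2n` contributes -16 R±; what is left beyond 16
  -- (-1)ⁿ is the vanishing 8 O + 2 H.
  S-n+S-2n : Cong 3 (S n + S (2 ℕ.* n)) ((1ℚ + 1ℚ) * sign n)
  S-n+S-2n = Cong-cancel-2 (Cong-cancel-2 (Cong-cancel-2 (by-diff (lem (S n) (S (2 ℕ.* n)) (sign n) O H R±)
    (Div-+ (Div-+ (Div-scale Div-8 (diff S-n)) (diff 8S-2n)) (Div-scale (Div-sign n) 8O+2H≡0)))))
    where
    lem : ∀ x y σ o h r → (1ℚ + 1ℚ) * ((1ℚ + 1ℚ) * (1ℚ + 1ℚ)) * (x - σ * (1ℚ + (1ℚ + 1ℚ) * r + o))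
      + ((1ℚ + 1ℚ) * ((1ℚ + 1ℚ) * (1ℚ + 1ℚ)) * y - σ * ((1ℚ + 1ℚ) * ((1ℚ + 1ℚ) * (1ℚ + 1ℚ)) + (1ℚ + 1ℚ) * h - (1ℚ + 1ℚ) * ((1ℚ + 1ℚ) * ((1ℚ + 1ℚ) * (1ℚ + 1ℚ)) * r)))
      + σ * ((1ℚ + 1ℚ) * ((1ℚ + 1ℚ) * (1ℚ + 1ℚ)) * o + (1ℚ + 1ℚ) * h)
      ≡ (1ℚ + 1ℚ) * ((1ℚ + 1ℚ) * ((1ℚ + 1ℚ) * (x + y))) - (1ℚ + 1ℚ) * ((1ℚ + 1ℚ) * ((1ℚ + 1ℚ) * ((1ℚ + 1ℚ) * σ)))
    lem = solve-∀ ℚ-ring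

  -- Folding the range n < k < P

  b²-after-n : ℕ → ℚ
  b²-after-n i = b (suc n ℕ.+ i) * b (suc n ℕ.+ i)

  U : ℕ → ℚ
  U m = ∑ m b²-after-n

  S-split : ∀ m → S (n ℕ.+ m) ≡ S n + U m
  S-split m = ∑-split (suc n) m (λ k → b k * b k)

  -- The upper half of the range n < k < P is folded onto the lower half by b²-symmetric.
  S-2n-fold : ∀ m h → m ℕ.+ h ≡ n → Cong 3 (S (2 ℕ.* n)) (S n + (U m + U h))
  S-2n-fold m h m+h≡n = Cong-trans (Cong-reflexive split) (Cong-+ (Cong-refl {x = S n}) (Cong-+ (Cong-refl {x = U m}) (Cong-∑ h fold)))
    where
    split : S (2 ℕ.* n) ≡ S n + (U m + ∑ h (λ i → b²-after-n (m ℕ.+ (h ∸ suc i))))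
    split = trans (cong (λ k → S (n ℕ.+ k)) (ℕₚ.+-identityʳ n)) (trans (S-split n) (cong (λ z → S n + z)
      (trans (cong U (sym m+h≡n)) (trans (∑-split m h b²-after-n) (cong (λ z → U m + z) (∑-reverse h (λ i → b²-after-n (m ℕ.+ i))))))))
    fold : ∀ i → i < h → Cong 3 (b²-after-n (m ℕ.+ (h ∸ suc i))) (b²-after-n i)
    fold i i<h = subst (λ j → Cong 3 (b²-after-n j) (b²-after-n i)) (trans (cong (_∸ i) (sym eq)) (ℕₚ.m+n∸n≡m (m ℕ.+ (h ∸ suc i)) i))
      (b²-symmetric i (subst (i ≤_) eq (ℕₚ.m≤n+m i (m ℕ.+ (h ∸ suc i)))))
      where
      eqℕ : ∀ m i j → suc (m ℕ.+ j ℕ.+ i) ≡ m ℕ.+ (suc i ℕ.+ j)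
      eqℕ = ℕ-Solver.solve-∀
      eq : m ℕ.+ (h ∸ suc i) ℕ.+ i ≡ n′
      eq = ℕₚ.suc-injective (trans (eqℕ m i (h ∸ suc i)) (trans (cong (m ℕ.+_) (ℕₚ.m+[n∸m]≡n i<h)) m+h≡n))

  S-even : ∀ h → h ℕ.+ h ≡ n → Cong 3 (S (n ℕ.+ h)) (sign n)
  S-even h h+h≡n = Cong-cancel-2 (Cong-trans (Cong-sym (Cong-trans (Cong-+ (Cong-refl {x = S n}) (S-2n-fold h h h+h≡n))
      (Cong-reflexive (trans (lem (S n) (U h)) (cong ((1ℚ + 1ℚ) *_) (sym (S-split h))))))) S-n+S-2n)
    where
    lem : ∀ x u → x + (x + (u + u)) ≡ (1ℚ + 1ℚ) * (x + u)
    lem = solve-∀ ℚ-ring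

  2S-odd : ∀ h → h ℕ.+ h ≡ n′ → Cong 3 ((1ℚ + 1ℚ) * S (suc n ℕ.+ h)) ((1ℚ + 1ℚ) * sign n + b²-after-n h)
  2S-odd h h+h≡n′ = Cong-trans (Cong-trans (Cong-reflexive (trans (cong (λ k → (1ℚ + 1ℚ) * S k) (sym (ℕₚ.+-suc n h)))
        (trans (cong ((1ℚ + 1ℚ) *_) (S-split (suc h))) (lem (S n) (U h) (b²-after-n h)))))
      -- For odd n the two pieces have lengths h + 1 and h: the index n + 1 + h is fixed by the
      -- reflection, so its term is added once more.
      (Cong-+ (Cong-sym (Cong-+ (Cong-refl {x = S n}) (S-2n-fold (suc h) h (cong suc h+h≡n′)))) (Cong-refl {x = b²-after-n h})))
    (Cong-+ S-n+S-2n Cong-refl)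
    where
    lem : ∀ x u f → (1ℚ + 1ℚ) * (x + (u + f)) ≡ x + (x + (u + f + u)) + f
    lem = solve-∀ ℚ-ring

  -- A second factor p in b

  Div-b-suc : ∀ {e} k → ¬ (p ∣ suc k) → Div e (ι (suc (2 ℕ.* k)) * b k) → Div e (b (suc k))
  Div-b-suc k p∤ d = subst (Div _) (lem (b k) (ι (suc (2 ℕ.* k))) (inv (2 ℕ.* suc k))) (Div-scale (Div-inv (p∤* p∤2 p∤)) d)
    where
    lem : ∀ b o i → i * (o * b) ≡ b * (o * i)
    lem = solve-∀ ℚ-ring

  Div-multiple : ∀ {m} → p ∣ m → Div 1 (ι m)
  Div-multiple (divides q refl) = subst (Div 1) (sym (ι-* q p)) (Div-scale (Div-ι q) (subst (Div 1) (cong ι (ℕₚ.^-identityʳ p)) (Div-p^ 1)))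

  -- The step from k to k + 1 multiplies by 2k + 1 and so gains a p; no denominator up to the final
  -- index loses one.
  Div2-b : ∀ k d → p ∣ suc (2 ℕ.* k) → (∀ e → e ≤ d → ¬ (p ∣ suc k ℕ.+ e)) → Div 1 (b k) → Div 2 (b (suc k ℕ.+ d))
  Div2-b k zero    p∣ p∤ bk = subst (λ m → Div 2 (b m)) (sym (ℕₚ.+-identityʳ (suc k)))
    (Div-b-suc k (subst (λ m → ¬ (p ∣ m)) (ℕₚ.+-identityʳ (suc k)) (p∤ 0 z≤n)) (Div-* {1} {1} (Div-multiple p∣) bk))
  Div2-b k (suc d) p∣ p∤ bk = subst (λ m → Div 2 (b m)) (sym (ℕₚ.+-suc (suc k) d))
    (Div-b-suc (suc k ℕ.+ d) (subst (λ m → ¬ (p ∣ m)) (ℕₚ.+-suc (suc k) d) (p∤ (suc d) ℕₚ.≤-refl))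
      (Div-scale (Div-ι (suc (2 ℕ.* (suc k ℕ.+ d)))) (Div2-b k d p∣ (λ e e≤d → p∤ e (ℕₚ.m≤n⇒m≤1+n e≤d)) bk)))

-- Translation of sums, signs and floors

sumTo-term : ∀ N → sumTo N term ≡ S N
sumTo-term N = trans (sumTo-∑ N term) (∑-cong (suc N) (λ k _ → term-b k))

ℤtoℚ-sign : ∀ m → ℤtoℚ ((ℤ.- ℤ.1ℤ) ℤ.^ m) ≡ sign m
ℤtoℚ-sign zero    = refl
ℤtoℚ-sign (suc m) = trans (ℤtoℚ-* (ℤ.- ℤ.1ℤ) ((ℤ.- ℤ.1ℤ) ℤ.^ m)) (trans (cong (λ z → - 1ℚ * z) (ℤtoℚ-sign m)) (lem (sign m)))
  where
  lem : ∀ s → - 1ℚ * s ≡ - s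
  lem = solve-∀ ℚ-ring

sign-*-even : ∀ a m → sign (a ℕ.* (2 ℕ.* m)) ≡ 1ℚ
sign-*-even a m = trans (cong sign (eqℕ a m)) (sign-even (a ℕ.* m))
  where
  eqℕ : ∀ a m → a ℕ.* (2 ℕ.* m) ≡ 2 ℕ.* (a ℕ.* m)
  eqℕ = ℕ-Solver.solve-∀

sign-*-odd : ∀ a m → sign (a ℕ.* suc (2 ℕ.* m)) ≡ sign a
sign-*-odd a m = trans (cong sign (eqℕ a m)) (trans (sign-+ a (2 ℕ.* (a ℕ.* m)))
  (trans (cong (sign a *_) (sign-even (a ℕ.* m))) (ℚₚ.*-identityʳ (sign a))))
  where
  eqℕ : ∀ a m → a ℕ.* suc (2 ℕ.* m) ≡ a ℕ.+ 2 ℕ.* (a ℕ.* m)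
  eqℕ = ℕ-Solver.solve-∀

quotient : ∀ {r d} q .{{_ : NonZero d}} → r < d → (r ℕ.+ q ℕ.* d) / d ≡ q
quotient {r} {d} q r<d = trans (+-distrib-/-∣ʳ r (n∣m*n q)) (cong₂ ℕ._+_ (m<n⇒m/n≡0 r<d) (m*n/n≡m q d))

3[4h+1]/4 : ∀ h → (3 ℕ.* suc (4 ℕ.* h)) / 4 ≡ 3 ℕ.* h
3[4h+1]/4 h = trans (cong (_/ 4) (eqℕ h)) (quotient {3} {4} (3 ℕ.* h) (s≤s (s≤s (s≤s (s≤s z≤n)))))
  where
  eqℕ : ∀ h → 3 ℕ.* suc (4 ℕ.* h) ≡ 3 ℕ.+ 3 ℕ.* h ℕ.* 4
  eqℕ = ℕ-Solver.solve-∀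

3[4h+3]/4 : ∀ h → (3 ℕ.* (3 ℕ.+ 4 ℕ.* h)) / 4 ≡ 2 ℕ.+ 3 ℕ.* h
3[4h+3]/4 h = trans (cong (_/ 4) (eqℕ h)) (quotient {1} {4} (2 ℕ.+ 3 ℕ.* h) (s≤s (s≤s z≤n)))
  where
  eqℕ : ∀ h → 3 ℕ.* (3 ℕ.+ 4 ℕ.* h) ≡ 1 ℕ.+ (2 ℕ.+ 3 ℕ.* h) ℕ.* 4
  eqℕ = ℕ-Solver.solve-∀

-- The sum by the residue of p ^ a modulo 4

module _ (p : ℕ) (p-prime : Prime p) (p∤2 : ¬ (p ∣ 2)) where

  open Localization p p-prime

  sum-1mod4 : ∀ a h → p ^ a ≡ suc (4 ℕ.* suc h) → Cong 3 (sumTo ((3 ℕ.* p ^ a) / 4) term) 1ℚ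
  sum-1mod4 a h p^a≡ = subst₂ (Cong 3) (sym eq) sgn (S-even (suc h) refl)
    where
    eqℕ : ∀ h → suc (4 ℕ.* suc h) ≡ suc (2 ℕ.* (suc h ℕ.+ suc h))
    eqℕ = ℕ-Solver.solve-∀
    eqℕ′ : ∀ h → 3 ℕ.* h ≡ h ℕ.+ h ℕ.+ h
    eqℕ′ = ℕ-Solver.solve-∀
    open PrimePower p p-prime p∤2 a (h ℕ.+ suc h) (trans p^a≡ (eqℕ h)) using (S-even)
    eq : sumTo ((3 ℕ.* p ^ a) / 4) term ≡ S (suc h ℕ.+ suc h ℕ.+ suc h)
    eq = trans (cong (λ m → sumTo ((3 ℕ.* m) / 4) term) p^a≡) (trans (cong (λ m → sumTo m term) (trans (3[4h+1]/4 (suc h)) (eqℕ′ (suc h))))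
      (sumTo-term (suc h ℕ.+ suc h ℕ.+ suc h)))
    sgn : sign (suc h ℕ.+ suc h) ≡ 1ℚ
    sgn = trans (sign-+ (suc h) (suc h)) (sign² (suc h))

  module _ (a h : ℕ) (p^a≡ : p ^ a ≡ 3 ℕ.+ 4 ℕ.* h) where

    private
      n = suc (h ℕ.+ h)
      eqℕ : ∀ h → 3 ℕ.+ 4 ℕ.* h ≡ suc (2 ℕ.* suc (h ℕ.+ h))
      eqℕ = ℕ-Solver.solve-∀
      module PP = PrimePower p p-prime p∤2 a (h ℕ.+ h) (trans p^a≡ (eqℕ h))

    2sum-3mod4 : Cong 3 ((1ℚ + 1ℚ) * sumTo ((3 ℕ.* p ^ a) / 4) term) ((1ℚ + 1ℚ) * - 1ℚ + b (suc n ℕ.+ h) * b (suc n ℕ.+ h))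
    2sum-3mod4 = subst₂ (Cong 3) (sym eq) (cong (λ z → (1ℚ + 1ℚ) * - z + b (suc n ℕ.+ h) * b (suc n ℕ.+ h)) (trans (sign-+ h h) (sign² h)))
        (PP.2S-odd h refl)
      where
      eqℕ′ : ∀ h → 2 ℕ.+ 3 ℕ.* h ≡ suc (suc (h ℕ.+ h)) ℕ.+ h
      eqℕ′ = ℕ-Solver.solve-∀
      eq : (1ℚ + 1ℚ) * sumTo ((3 ℕ.* p ^ a) / 4) term ≡ (1ℚ + 1ℚ) * S (suc n ℕ.+ h)
      eq = cong ((1ℚ + 1ℚ) *_) (trans (cong (λ m → sumTo ((3 ℕ.* m) / 4) term) p^a≡) (trans (cong (λ m → sumTo m term) (trans (3[4h+3]/4 h) (eqℕ′ h)))
        (sumTo-term (suc n ℕ.+ h))))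

    sum-3mod4-vanishing : Div 2 (b (suc n ℕ.+ h)) → Cong 3 (sumTo ((3 ℕ.* p ^ a) / 4) term) (- 1ℚ)
    sum-3mod4-vanishing d = PP.Cong-cancel-2 (Cong-trans 2sum-3mod4 (by-diff (lem (b (suc n ℕ.+ h)) ((1ℚ + 1ℚ) * - 1ℚ)) (Div-pred (Div-* {2} {2} d d))))
      where
      lem : ∀ x y → x * x ≡ y + x * x - y
      lem = solve-∀ ℚ-ring

    -- The central term is the one with i = h = (P - 3)/4 in row n - 1 = (P - 3)/2, hence P² /
    -- binom(2h,h)². The 2 in the denominator comes from halving the folded sum.
    sum-3mod4 : Cong 3 (sumTo ((3 ℕ.* p ^ a) / 4) term)
      (- 1ℚ + natFrac ((p ^ a) ^ 2) (2 ℕ.* ((((p ^ a ∸ 3) / 2) C ((p ^ a ∸ 3) / 4)) ^ 2)))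
    sum-3mod4 = PP.Cong-cancel-2 (Cong-trans 2sum-3mod4 (Cong-trans
        (Cong-+ (Cong-refl {x = (1ℚ + 1ℚ) * - 1ℚ}) (PP.b²-upper-Cong h (ℕₚ.m≤m+n h h)))
        (Cong-reflexive (trans (cong (λ z → (1ℚ + 1ℚ) * - 1ℚ + z) eq) (sym (ℚₚ.*-distribˡ-+ (1ℚ + 1ℚ) (- 1ℚ) frac))))))
      where
      c = (h ℕ.+ h) C h
      instance c≢0 = nCk≢0 {h ℕ.+ h} {h} (ℕₚ.m≤m+n h h)
      frac = natFrac ((p ^ a) ^ 2) (2 ℕ.* ((((p ^ a ∸ 3) / 2) C ((p ^ a ∸ 3) / 4)) ^ 2))
      ∸3/2 : (p ^ a ∸ 3) / 2 ≡ h ℕ.+ h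
      ∸3/2 = trans (cong (λ m → (m ∸ 3) / 2) p^a≡) (trans (cong (_/ 2) (eqℕ₂ h)) (m*n/n≡m (h ℕ.+ h) 2))
        where
        eqℕ₂ : ∀ h → 4 ℕ.* h ≡ (h ℕ.+ h) ℕ.* 2
        eqℕ₂ = ℕ-Solver.solve-∀
      ∸3/4 : (p ^ a ∸ 3) / 4 ≡ h
      ∸3/4 = trans (cong (λ m → (m ∸ 3) / 4) p^a≡) (trans (cong (_/ 4) (ℕₚ.*-comm 4 h)) (m*n/n≡m h 4))
      ι-sq : ∀ m → ι (m ^ 2) ≡ ι m * ι m
      ι-sq m = trans (ι-* m (m ℕ.* 1)) (cong (λ k → ι m * ι k) (ℕₚ.*-identityʳ m))
      instance
        c²≢0 : NonZero (c ^ 2)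
        c²≢0 = ℕₚ.m^n≢0 c 2
        2c²≢0 : NonZero (2 ℕ.* c ^ 2)
        2c²≢0 = ℕₚ.m*n≢0 2 (c ^ 2)
      lem₁ : ∀ P i → P * i * (P * i) ≡ P * P * (i * i)
      lem₁ = solve-∀ ℚ-ring
      lem₂ : ∀ t c i j → (t * (c * c)) * i ≡ 1ℚ → c * j ≡ 1ℚ → j * j ≡ t * i
      lem₂ t c i j h₁ h₂ = linear₂ (- (j * j)) (t * i * (c * j + 1ℚ)) h₁ h₂ (lem₃ t c i j)
        where
        lem₃ : ∀ t c i j → j * j - t * i ≡ - (j * j) * (t * (c * c) * i - 1ℚ) + t * i * (c * j + 1ℚ) * (c * j - 1ℚ)
        lem₃ = solve-∀ ℚ-ring
      lem₄ : ∀ x t i → x * (t * i) ≡ t * (x * i)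
      lem₄ = solve-∀ ℚ-ring
      eq : PP.P/C h * PP.P/C h ≡ (1ℚ + 1ℚ) * frac
      eq = trans (lem₁ (ι PP.P) (inv c)) (trans (cong₂ (λ x y → ι x * ι x * y) (sym (trans p^a≡ (eqℕ h)))
             (lem₂ (1ℚ + 1ℚ) (ι c) (inv (2 ℕ.* c ^ 2)) (inv c)
               (trans (cong (_* inv (2 ℕ.* c ^ 2)) (sym (trans (ι-* 2 (c ^ 2)) (cong₂ _*_ (trans (ι-2* 1) (cong₂ _+_ ι-1 ι-1)) (ι-sq c))))) (ι-inv (2 ℕ.* c ^ 2)))
               (ι-inv c)))
           (trans (lem₄ (ι (p ^ a) * ι (p ^ a)) (1ℚ + 1ℚ) (inv (2 ℕ.* c ^ 2))) (cong ((1ℚ + 1ℚ) *_)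
             (trans (cong (_* inv (2 ℕ.* c ^ 2)) (sym (ι-sq (p ^ a)))) (trans (sym (natFrac-ι ((p ^ a) ^ 2) (2 ℕ.* c ^ 2)))
               (cong₂ (λ x y → natFrac ((p ^ a) ^ 2) (2 ℕ.* ((x C y) ^ 2))) (sym ∸3/2) (sym ∸3/4)))))))

-- Powers of a prime p ≡ 3 (mod 4)

module _ (g : ℕ) (p-prime : Prime (3 ℕ.+ 4 ℕ.* g)) (p∤2 : ¬ (3 ℕ.+ 4 ℕ.* g ∣ 2)) where

  private
    p : ℕ
    p = 3 ℕ.+ 4 ℕ.* g

  open Localization p p-prime

  -- For P = p ^ (a + 1) = p (4 f + 1) the central index is 3 f p + (3 p - 1) / 4; the step from
  -- k = 3 f p + (p - 1) / 2 to k + 1 multiplies b by 2 k + 1, a multiple of p.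
  sum-3mod4-high : ∀ a f → p ^ a ≡ suc (4 ℕ.* suc f) → Cong 3 (sumTo ((3 ℕ.* p ^ suc a) / 4) term) (- 1ℚ)
  sum-3mod4-high a f p^a≡ = sum-3mod4-vanishing p p-prime p∤2 (suc a) h p^1+a≡
      -- The first factor p of `b k` is present since k > n, and g further steps lead from k + 1 to
      -- the central index.
      (subst (λ m → Div 2 (b m)) (eqN g f) (PP.Div2-b k g p∣2k+1 p∤ (PP.Div-b-upper i i≤)))
    where
    h = g ℕ.+ suc f ℕ.* p
    i = 2 ℕ.+ 4 ℕ.* g ℕ.+ f ℕ.* p
    n = suc (h ℕ.+ h)
    k = suc n ℕ.+ i
    eqP : ∀ g f → (3 ℕ.+ 4 ℕ.* g) ℕ.* suc (4 ℕ.* suc f) ≡ 3 ℕ.+ 4 ℕ.* (g ℕ.+ suc f ℕ.* (3 ℕ.+ 4 ℕ.* g))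
    eqP = ℕ-Solver.solve-∀
    p^1+a≡ : p ^ suc a ≡ 3 ℕ.+ 4 ℕ.* h
    p^1+a≡ = trans (cong (p ℕ.*_) p^a≡) (eqP g f)
    eqn : ∀ h → 3 ℕ.+ 4 ℕ.* h ≡ suc (2 ℕ.* suc (h ℕ.+ h))
    eqn = ℕ-Solver.solve-∀
    module PP = PrimePower p p-prime p∤2 (suc a) (h ℕ.+ h) (trans p^1+a≡ (eqn h))
    eqN : ∀ g f → let p = 3 ℕ.+ 4 ℕ.* g; h = g ℕ.+ suc f ℕ.* p in
          suc (suc (suc (h ℕ.+ h)) ℕ.+ (2 ℕ.+ 4 ℕ.* g ℕ.+ f ℕ.* p)) ℕ.+ g ≡ suc (suc (h ℕ.+ h)) ℕ.+ h
    eqN g f = lem (g ℕ.+ suc f ℕ.* (3 ℕ.+ 4 ℕ.* g)) (2 ℕ.+ 4 ℕ.* g ℕ.+ f ℕ.* (3 ℕ.+ 4 ℕ.* g)) g (lem′ g f)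
      where
      lem″ : ∀ x y → suc (suc (x ℕ.+ x)) ℕ.+ suc y ≡ suc (suc (suc (x ℕ.+ x)) ℕ.+ y)
      lem″ = ℕ-Solver.solve-∀
      lem′ : ∀ g f → suc (2 ℕ.+ 4 ℕ.* g ℕ.+ f ℕ.* (3 ℕ.+ 4 ℕ.* g)) ℕ.+ g ≡ g ℕ.+ suc f ℕ.* (3 ℕ.+ 4 ℕ.* g)
      lem′ = ℕ-Solver.solve-∀
      lem : ∀ h i g → suc i ℕ.+ g ≡ h → suc (suc (suc (h ℕ.+ h)) ℕ.+ i) ℕ.+ g ≡ suc (suc (h ℕ.+ h)) ℕ.+ h
      lem h i g eq = trans (cong (ℕ._+ g) (sym (lem″ h i))) (trans (ℕₚ.+-assoc (suc (suc (h ℕ.+ h))) (suc i) g) (cong (suc (suc (h ℕ.+ h)) ℕ.+_) eq))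
    i≤ : i ≤ h ℕ.+ h
    i≤ = ℕₚ.≤-trans (ℕₚ.≤-trans (ℕₚ.n≤1+n i) (ℕₚ.m≤n+m (suc i) g)) (ℕₚ.m≤m+n h h)
    eq-odd : ∀ g f → let p = 3 ℕ.+ 4 ℕ.* g; h = g ℕ.+ suc f ℕ.* p in
             suc (2 ℕ.* (suc (suc (h ℕ.+ h)) ℕ.+ (2 ℕ.+ 4 ℕ.* g ℕ.+ f ℕ.* p))) ≡ (7 ℕ.+ 6 ℕ.* f) ℕ.* p
    eq-odd = ℕ-Solver.solve-∀
    p∣2k+1 : p ∣ suc (2 ℕ.* k)
    p∣2k+1 = divides (7 ℕ.+ 6 ℕ.* f) (eq-odd g f)
    eq-e : ∀ g f e → let p = 3 ℕ.+ 4 ℕ.* g; h = g ℕ.+ suc f ℕ.* p in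
           suc (suc (suc (h ℕ.+ h)) ℕ.+ (2 ℕ.+ 4 ℕ.* g ℕ.+ f ℕ.* p)) ℕ.+ e ≡ (3 ℕ.* suc f) ℕ.* p ℕ.+ suc (suc (2 ℕ.* g ℕ.+ e))
    eq-e = ℕ-Solver.solve-∀
    p∤ : ∀ e → e ≤ g → ¬ (p ∣ suc k ℕ.+ e)
    -- Modulo p the index is 2g + 2 + e, which lies between 0 and p = 4g + 3.
    p∤ e e≤g p∣ = >⇒∤ (s≤s (s≤s (s≤s (ℕₚ.≤-trans (ℕₚ.+-monoʳ-≤ (2 ℕ.* g) e≤g) (subst (2 ℕ.* g ℕ.+ g ≤_) (lem g) (ℕₚ.m≤m+n (2 ℕ.* g ℕ.+ g) g))))))
      (∣m+n∣m⇒∣n (subst (p ∣_) (eq-e g f e) p∣) (n∣m*n (3 ℕ.* suc f)))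
      where
      lem : ∀ g → 2 ℕ.* g ℕ.+ g ℕ.+ g ≡ 4 ℕ.* g
      lem = ℕ-Solver.solve-∀

  -- Multiplication by p swaps the classes 1 and 3 modulo 4, so the class and the sign (-1)ᵃ change
  -- together.
  ^-mod4 : ∀ a → (∃[ f ] (p ^ a ≡ suc (4 ℕ.* f)) × sign a ≡ 1ℚ) ⊎ (∃[ f ] (p ^ a ≡ 3 ℕ.+ 4 ℕ.* f) × sign a ≡ - 1ℚ)
  ^-mod4 zero    = inj₁ (0 , refl , refl)
  ^-mod4 (suc a) with ^-mod4 a
  ... | inj₁ (f , eq , sgn) = inj₂ (g ℕ.+ f ℕ.* p , trans (cong (p ℕ.*_) eq) (eqℕ g f) , cong -_ sgn)
    where
    eqℕ : ∀ g f → (3 ℕ.+ 4 ℕ.* g) ℕ.* suc (4 ℕ.* f) ≡ 3 ℕ.+ 4 ℕ.* (g ℕ.+ f ℕ.* (3 ℕ.+ 4 ℕ.* g))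
    eqℕ = ℕ-Solver.solve-∀
  ... | inj₂ (f , eq , sgn) = inj₁ (2 ℕ.+ 3 ℕ.* g ℕ.+ f ℕ.* p , trans (cong (p ℕ.*_) eq) (eqℕ g f) , cong -_ sgn)
    where
    eqℕ : ∀ g f → (3 ℕ.+ 4 ℕ.* g) ℕ.* (3 ℕ.+ 4 ℕ.* f) ≡ suc (4 ℕ.* (2 ℕ.+ 3 ℕ.* g ℕ.+ f ℕ.* (3 ℕ.+ 4 ℕ.* g)))
    eqℕ = ℕ-Solver.solve-∀

  p^≢1 : ∀ a → ¬ (p ^ suc a ≡ 1)
  p^≢1 a eq with ℕₚ.m*n≡1⇒m≡1 p (p ^ a) eq
  ... | ()

  sum-3mod4-power : ∀ a → 2 ≤ a → Cong 3 (sumTo ((3 ℕ.* p ^ a) / 4) term) (sign a)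
  sum-3mod4-power (suc a@(suc a′)) (s≤s (s≤s z≤n)) with ^-mod4 a
  -- The case f = 0 would mean that a positive power of p equals 1; it is here that the exponent 1
  -- is excluded.
  ... | inj₁ (zero  , eq , _)   = contradiction eq (p^≢1 a′)
  ... | inj₁ (suc f , eq , sgn) = subst (Cong 3 _) (cong -_ (sym sgn)) (sum-3mod4-high a f eq)
  ... | inj₂ (f     , eq , sgn) = subst (Cong 3 _) (cong -_ (sym sgn))
      (sum-1mod4 p p-prime p∤2 (suc a) (1 ℕ.+ 3 ℕ.* g ℕ.+ f ℕ.* p) (trans (cong (p ℕ.*_) eq) (eqℕ g f)))
    where
    eqℕ : ∀ g f → (3 ℕ.+ 4 ℕ.* g) ℕ.* (3 ℕ.+ 4 ℕ.* f) ≡ suc (4 ℕ.* suc (1 ℕ.+ 3 ℕ.* g ℕ.+ f ℕ.* (3 ℕ.+ 4 ℕ.* g)))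
    eqℕ = ℕ-Solver.solve-∀

-- Odd primes modulo 4 and the theorem

^-1mod4 : ∀ g a → ∃[ h ] suc (4 ℕ.* suc g) ^ suc a ≡ suc (4 ℕ.* suc h)
^-1mod4 g zero    = g , ℕₚ.*-identityʳ (suc (4 ℕ.* suc g))
^-1mod4 g (suc a) with ^-1mod4 g a
... | h , eq = g ℕ.+ suc h ℕ.* suc (4 ℕ.* suc g) , trans (cong (suc (4 ℕ.* suc g) ℕ.*_) eq) (eqℕ g h)
  where
  eqℕ : ∀ g h → suc (4 ℕ.* suc g) ℕ.* suc (4 ℕ.* suc h) ≡ suc (4 ℕ.* suc (g ℕ.+ suc h ℕ.* suc (4 ℕ.* suc g)))
  eqℕ = ℕ-Solver.solve-∀

odd-prime-mod4 : ∀ {p} → Prime p → p % 2 ≡ 1 → (∃[ g ] p ≡ suc (4 ℕ.* suc g)) ⊎ (∃[ g ] p ≡ 3 ℕ.+ 4 ℕ.* g)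
odd-prime-mod4 {p} p-prime p%2≡1 with parity (p / 2)
  where
  parity : ∀ q → (∃[ g ] q ≡ 2 ℕ.* g) ⊎ (∃[ g ] q ≡ suc (2 ℕ.* g))
  parity zero = inj₁ (0 , refl)
  parity (suc q) with parity q
  ... | inj₁ (g , eq) = inj₂ (g , cong suc eq)
  ... | inj₂ (g , eq) = inj₁ (suc g , trans (cong suc eq) (sym (2*-suc g)))
... | inj₁ (zero , eq) = contradiction (subst Prime (trans (m≡m%n+[m/n]*n p 2) (cong₂ (λ r q → r ℕ.+ q ℕ.* 2) p%2≡1 eq)) p-prime) ¬prime[1]
... | inj₁ (suc g , eq) = inj₁ (g , trans (m≡m%n+[m/n]*n p 2) (trans (cong₂ (λ r q → r ℕ.+ q ℕ.* 2) p%2≡1 eq) (eqℕ g)))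
  where
  eqℕ : ∀ g → 1 ℕ.+ 2 ℕ.* suc g ℕ.* 2 ≡ suc (4 ℕ.* suc g)
  eqℕ = ℕ-Solver.solve-∀
... | inj₂ (g , eq) = inj₂ (g , trans (m≡m%n+[m/n]*n p 2) (trans (cong₂ (λ r q → r ℕ.+ q ℕ.* 2) p%2≡1 eq) (eqℕ g)))
  where
  eqℕ : ∀ g → 1 ℕ.+ suc (2 ℕ.* g) ℕ.* 2 ≡ 3 ℕ.+ 4 ℕ.* g
  eqℕ = ℕ-Solver.solve-∀

theorem1p1 : (p : ℕ) → Prime p → p % 2 ≡ 1 →
    ((p % 4 ≡ 1 → sumTo ((3 ℕ.* p) / 4) term ≡ ℚ.1ℚ [modℚ p ^ 3 ])
    × (p % 4 ≡ 3 →
    sumTo ((3 ℕ.* p) / 4) term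
    ≡ ℚ.- ℚ.1ℚ ℚ.+ natFrac (p ^ 2) (2 ℕ.* ((((p ∸ 3) / 2) C ((p ∸ 3) / 4)) ^ 2))
    [modℚ p ^ 3 ]))
    × ((a : ℕ) → 2 ≤ a →
    sumTo ((3 ℕ.* (p ^ a)) / 4) term ≡ ℤtoℚ (jacobiNeg1 p a) [modℚ p ^ 3 ])
theorem1p1 p p-prime p%2≡1 with odd-prime-mod4 p-prime p%2≡1
... | inj₁ (g , refl) = (i₁ , i₃) , ii
  where
  open Localization p p-prime
  p∤2 : ¬ (p ∣ 2)
  p∤2 = >⇒∤ (s≤s (subst (2 ≤_) (sym (ℕₚ.*-suc 4 g)) (s≤s (s≤s z≤n))))
  p%4≡1 : p % 4 ≡ 1
  p%4≡1 = trans (cong (λ m → suc m % 4) (ℕₚ.*-comm 4 (suc g))) ([m+kn]%n≡m%n 1 (suc g) 4)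
  i₁ : p % 4 ≡ 1 → sumTo ((3 ℕ.* p) / 4) term ≡ 1ℚ [modℚ p ^ 3 ]
  i₁ _ = Cong⇒modℚ (subst (λ m → Cong 3 (sumTo ((3 ℕ.* m) / 4) term) 1ℚ) (ℕₚ.^-identityʳ p)
    (sum-1mod4 p p-prime p∤2 1 g (ℕₚ.^-identityʳ p)))
  i₃ : p % 4 ≡ 3 → _
  i₃ p%4≡3 = contradiction (trans (sym p%4≡1) p%4≡3) (λ ())
  jac : ∀ a → ℤtoℚ (jacobiNeg1 p a) ≡ 1ℚ
  jac a = trans (ℤtoℚ-sign (a ℕ.* ((p ∸ 1) / 2))) (trans (cong (λ m → sign (a ℕ.* m)) half) (sign-*-even a (suc g)))
    where
    eqℕ : ∀ g → 4 ℕ.* suc g ≡ 2 ℕ.* suc g ℕ.* 2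
    eqℕ = ℕ-Solver.solve-∀
    half : (p ∸ 1) / 2 ≡ 2 ℕ.* suc g
    half = trans (cong (_/ 2) (eqℕ g)) (m*n/n≡m (2 ℕ.* suc g) 2)
  ii : ∀ a → 2 ≤ a → sumTo ((3 ℕ.* (p ^ a)) / 4) term ≡ ℤtoℚ (jacobiNeg1 p a) [modℚ p ^ 3 ]
  ii (suc a) _ with ^-1mod4 g a
  ... | h , eq = Cong⇒modℚ (subst (Cong 3 _) (sym (jac (suc a))) (sum-1mod4 p p-prime p∤2 (suc a) h eq))
... | inj₂ (g , refl) = (i₁ , i₃) , ii
  where
  open Localization p p-prime
  p∤2 : ¬ (p ∣ 2)
  p∤2 = >⇒∤ (s≤s (s≤s (s≤s z≤n)))
  p%4≡3 : p % 4 ≡ 3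
  p%4≡3 = trans (cong (λ m → (3 ℕ.+ m) % 4) (ℕₚ.*-comm 4 g)) ([m+kn]%n≡m%n 3 g 4)
  i₁ : p % 4 ≡ 1 → _
  i₁ p%4≡1 = contradiction (trans (sym p%4≡3) p%4≡1) (λ ())
  i₃ : p % 4 ≡ 3 → _
  i₃ _ = Cong⇒modℚ (subst (λ m → Cong 3 (sumTo ((3 ℕ.* m) / 4) term)
      (- 1ℚ + natFrac (m ^ 2) (2 ℕ.* ((((m ∸ 3) / 2) C ((m ∸ 3) / 4)) ^ 2)))) (ℕₚ.^-identityʳ p)
    (sum-3mod4 p p-prime p∤2 1 g (ℕₚ.^-identityʳ p)))
  jac : ∀ a → ℤtoℚ (jacobiNeg1 p a) ≡ sign a
  jac a = trans (ℤtoℚ-sign (a ℕ.* ((p ∸ 1) / 2))) (trans (cong (λ m → sign (a ℕ.* m)) half) (sign-*-odd a g))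
    where
    eqℕ : ∀ g → 2 ℕ.+ 4 ℕ.* g ≡ suc (2 ℕ.* g) ℕ.* 2
    eqℕ = ℕ-Solver.solve-∀
    half : (p ∸ 1) / 2 ≡ suc (2 ℕ.* g)
    half = trans (cong (_/ 2) (eqℕ g)) (m*n/n≡m (suc (2 ℕ.* g)) 2)
  ii : ∀ a → 2 ≤ a → sumTo ((3 ℕ.* (p ^ a)) / 4) term ≡ ℤtoℚ (jacobiNeg1 p a) [modℚ p ^ 3 ]
  ii a 2≤a = Cong⇒modℚ (subst (Cong 3 _) (sym (jac a)) (sum-3mod4-power g p-prime p∤2 a 2≤a))
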